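{- Let $\eta,\eta'\in\Omega^*$. Then $\nu_{\eta'}\prec\nu_{\eta}$ if and only if $\eta'\in\overline{o}_-(\eta)$.
   Context: $\mathbb{N}=\{1,2,3,\dots\}$, $\beta\mathbb{N}$ is its Stone–Čech compactification and $\mathbb{N}^*=\beta\mathbb{N}\setminus\mathbb{N}$, whose points are the free ultrafilters on $\mathbb{N}$. Let $\tau:\beta\mathbb{N}\to\beta\mathbb{N}$ be the continuous extension of $n\mapsto n+1$; its restriction to $\mathbb{N}^*$ is a homeomorphism of $\mathbb{N}^*$ onto itself. $\Omega^*$ is the quotient space of $\mathbb{N}^*\times[0,1]$ obtained by identifying $(\omega,1)$ with $(\tau\omega,0)$ for all $\omega\in\mathbb{N}^*$. For $s\in\mathbb{R}$, the homeomorphism $\phi^s:\Omega^*\to\Omega^*$ is $\phi^s(\omega,t)=(\tau^{[t+s]}\omega,\ t+s-[t+s])$, where $[x]$ is the largest integer not exceeding $x$. Put $o_-(\eta)=\{\phi^{ -s}(\eta): s\ge 0\}$ and let $\overline{o}_-(\eta)$ be its closure in $\Omega^*$. For $\eta=(\omega,t)\in\Omega^*$, with $\theta=2^t$, $\nu_\eta$ is the finitely additive probability measure on $\mathcal{P}(\mathbb{N})$ given by $\nu_\eta(A)=\omega\text{ - }\lim_n \frac{|A\cap\{1,\dots,[\theta\cdot 2^n]\}|}{\theta\cdot 2^n}$, the limit being taken along the ultrafilter $\omega$. For finitely additive probability measures $\mu,\nu$ on $\mathcal{P}(\mathbb{N})$, $\nu\prec\mu$ ($\nu$ is weakly absolutely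 continuous with respect to $\mu$) means that for all $A\in\mathcal{P}(\mathbb{N})$, $\mu(A)=0$ implies $\nu(A)=0$. -}

module Defs where

open import Level using (0ℓ) renaming (suc to lsuc)
open import Algebra.Bundles using (CommutativeRing; Semiring)
import Algebra.Definitions.RawMonoid as RawMonoidDefs
import Algebra.Definitions.RawSemiring as RawSemiringDefs
import Algebra.Properties.Ring as RingProperties
open import Axiom.ExcludedMiddle using (ExcludedMiddle)
open import Data.Empty using (⊥-elim)
open import Data.Integer.Base as ℤ using (ℤ; +_; -[1+_])
import Data.Integer.Properties as ℤₚ
open import Data.List.Base using (length; filter; applyUpTo)
open import Data.List.Properties using (length-filter; length-applyUpTo)
open import Data.Nat.Base as ℕ using (ℕ; zero; suc; z≤n; s≤s)
import Data.Nat.Properties as ℕₚ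
open import Data.Nat.GeneralisedArithmetic using (fold)
open import Data.Product.Base using (Σ; ∃; ∃-syntax; Σ-syntax; _×_; _,_; proj₁; proj₂)
open import Data.Sum.Base using (_⊎_; inj₁; inj₂)
open import Function.Base using (_∘_)
open import Relation.Binary.Core using (Rel)
open import Relation.Binary.Definitions using (tri<; tri≈; tri>; _Respects_)
open import Relation.Binary.Structures using (IsStrictTotalOrder)
open import Relation.Binary.PropositionalEquality.Core as ≡ using (_≡_)
import Relation.Binary.Construct.StrictToNonStrict as StrictToNonStrict
open import Relation.Binary.Construct.Closure.Equivalence using (EqClosure)
open import Relation.Nullary.Decidable.Core using (yes; no)
open import Relation.Nullary.Negation.Core using (¬_)
open import Relation.Unary using (Pred; _∈_; _∉_; _⊆_; _≐_; _∩_; ∁; ∅; U; Satisfiable; _≬_)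

-- The positive integers: [1+ n ] is n + 1.

record ℕ⁺ : Set where
  constructor [1+_]
  field
    pred : ℕ

open ℕ⁺ using (pred)

toℕ : ℕ⁺ → ℕ
toℕ n = suc (pred n)

suc⁺ : ℕ⁺ → ℕ⁺
suc⁺ n = [1+ toℕ n ]

𝒫ℕ⁺ : Set₁
𝒫ℕ⁺ = Pred ℕ⁺ 0ℓ

-- Ultrafilters on ℕ⁺, i.e. the points of βℕ⁺.

record Ultrafilter : Set₁ where
  field
    Large    : Pred 𝒫ℕ⁺ 0ℓ
    universe : U ∈ Large
    proper   : ∅ ∉ Large
    upward   : ∀ {A B} → A ⊆ B → A ∈ Large → B ∈ Large
    meet     : ∀ {A B} → A ∈ Large → B ∈ Large → (A ∩ B) ∈ Large
    total    : ∀ A → A ∈ Large ⊎ ∁ A ∈ Large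

open Ultrafilter public

Free : Pred Ultrafilter (lsuc 0ℓ)
Free ω = ∀ n → ∃[ A ] A ∈ Large ω × n ∉ A

ℕ* : Set₁
ℕ* = Σ Ultrafilter Free

infix 4 _∋_ _≈ᵤ_

_∋_ : ℕ* → 𝒫ℕ⁺ → Set
ω ∋ A = A ∈ Large (proj₁ ω)

_≈ᵤ_ : Rel ℕ* (lsuc 0ℓ)
ω ≈ᵤ ω′ = Large (proj₁ ω) ≐ Large (proj₁ ω′)

-- The continuous extension to βℕ⁺ of a self-map of ℕ⁺ sends an ultrafilter
-- to its image ultrafilter; this is the case of n ↦ n + 1.

τβ : Ultrafilter → Ultrafilter
τβ ω = record
  { Large    = λ A → (A ∘ suc⁺) ∈ Large ω
  ; universe = universe ω
  ; proper   = proper ω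
  ; upward   = λ A⊆B → upward ω A⊆B
  ; meet     = meet ω
  ; total    = λ A → total ω (A ∘ suc⁺)
  }

τ : ℕ* → ℕ*
τ (ω , free) = τβ ω , λ
  { [1+ zero  ] → (λ n → ∃[ k ] n ≡ suc⁺ k) , upward ω (λ {n} _ → n , ≡.refl) (universe ω)
                , λ ()
  ; [1+ suc n ] → let A , A∈ω , n∉A = free [1+ n ] in
                  (λ m → ∃[ k ] m ≡ suc⁺ k × k ∈ A)
                , upward ω (λ {k} k∈A → k , ≡.refl , k∈A) A∈ω
                , λ { (_ , ≡.refl , n∈A) → n∉A n∈A }
  }

suc⁺[_] : 𝒫ℕ⁺ → 𝒫ℕ⁺
suc⁺[ A ] n = ∃[ k ] k ∈ A × n ≡ suc⁺ k

-- The inverse of τ on ℕ*; see ττ⁻¹ and τ⁻¹τ.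

τ⁻¹ : ℕ* → ℕ*
τ⁻¹ (ω , free) = ω⁻ , free⁻
  where
  image : suc⁺[ U ] ∈ Large ω
  image with free [1+ zero ]
  ... | A , A∈ω , 1∉A = upward ω
    (λ { {[1+ zero ]} 1∈A → ⊥-elim (1∉A 1∈A) ; {[1+ suc n ]} _ → [1+ n ] , _ , ≡.refl }) A∈ω

  ω⁻ : Ultrafilter
  ω⁻ = record
    { Large    = λ A → suc⁺[ A ] ∈ Large ω
    ; universe = image
    ; proper   = λ p → proper ω (upward ω (λ { (_ , () , _) }) p)
    ; upward   = λ A⊆B → upward ω λ { (k , k∈A , eq) → k , A⊆B k∈A , eq }
    ; meet     = λ p q → upward ω
        (λ { ((k , k∈A , ≡.refl) , (.k , k∈B , ≡.refl)) → k , (k∈A , k∈B) , ≡.refl })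
        (meet ω p q)
    ; total    = total⁻
    }
    where
    total⁻ : ∀ A → suc⁺[ A ] ∈ Large ω ⊎ suc⁺[ ∁ A ] ∈ Large ω
    total⁻ A with total ω suc⁺[ A ]
    ... | inj₁ p = inj₁ p
    ... | inj₂ p = inj₂ (upward ω
      (λ { ((k , _ , ≡.refl) , k∉) → k , (λ k∈A → k∉ (k , k∈A , ≡.refl)) , ≡.refl })
      (meet ω image p))

  free⁻ : Free ω⁻
  free⁻ n with free (suc⁺ n)
  ... | A , A∈ω , n∉A = A ∘ suc⁺
    , upward ω (λ { (k∈A , (k , _ , ≡.refl)) → k , k∈A , ≡.refl }) (meet ω A∈ω image)
    , n∉A

ττ⁻¹ : ∀ ω → τ (τ⁻¹ ω) ≈ᵤ ω
ττ⁻¹ ω = (λ p → upward (proj₁ ω) (λ { (_ , q , ≡.refl) → q }) p)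
       , (λ p → upward (proj₁ ω) (λ { (q , (k , _ , ≡.refl)) → k , q , ≡.refl })
                  (meet (proj₁ ω) p (universe (proj₁ (τ⁻¹ ω)))))

τ⁻¹τ : ∀ ω → τ⁻¹ (τ ω) ≈ᵤ ω
τ⁻¹τ ω = (λ p → upward (proj₁ ω) (λ { (_ , q , ≡.refl) → q }) p)
       , (λ p → upward (proj₁ ω) (λ {k} q → k , q , ≡.refl) p)

τ^ : ℤ → ℕ* → ℕ*
τ^ (+ n)    ω = fold ω τ n
τ^ -[1+ n ] ω = fold ω τ⁻¹ (suc n)

-- ℝ enters as an arbitrary Dedekind-complete ordered field: classically there
-- is exactly one up to isomorphism.  ⁻¹ is unconstrained at 0.

record CompleteOrderedField : Set₁ where
  infix  4 _<_
  infix  8 _⁻¹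
  field
    commutativeRing : CommutativeRing 0ℓ 0ℓ

  open CommutativeRing commutativeRing public

  field
    _<_                : Rel Carrier 0ℓ
    isStrictTotalOrder : IsStrictTotalOrder _≈_ _<_
    +-monoˡ-<          : ∀ {x y} z → x < y → x + z < y + z
    *-pos              : ∀ {x y} → 0# < x → 0# < y → 0# < x * y
    0<1                : 0# < 1#
    _⁻¹                : Carrier → Carrier
    *-inverseʳ         : ∀ x → x ≉ 0# → x * x ⁻¹ ≈ 1#

  open StrictToNonStrict _≈_ _<_ public using (_≤_)

  UpperBound : Pred Carrier 0ℓ → Pred Carrier 0ℓ
  UpperBound S b = ∀ x → x ∈ S → x ≤ b

  IsSup : Pred Carrier 0ℓ → Pred Carrier 0ℓ
  IsSup S b = b ∈ UpperBound S × (∀ c → c ∈ UpperBound S → b ≤ c)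

  field
    sup : ∀ S → Satisfiable S → Satisfiable (UpperBound S) → ∃[ b ] b ∈ IsSup S

module OrderedField (R : CompleteOrderedField) where

  open CompleteOrderedField R public
  open RawMonoidDefs +-rawMonoid using () renaming (_×_ to _·_)
  open RawSemiringDefs (Semiring.rawSemiring semiring) public using (_^_)

  2# : Carrier
  2# = 1# + 1#

  fromℕ : ℕ → Carrier
  fromℕ n = n · 1#

  fromℤ : ℤ → Carrier
  fromℤ (+ n)    = fromℕ n
  fromℤ -[1+ n ] = - fromℕ (suc n)

  infix 4 ∣_-_∣<_

  -- |x - y| < ε
  ∣_-_∣<_ : Carrier → Carrier → Carrier → Set
  ∣ x - y ∣< ε = x < y + ε × y < x + ε

  I : Set
  I = Σ[ t ∈ Carrier ] 0# ≤ t × t ≤ 1#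

  module O = IsStrictTotalOrder isStrictTotalOrder
  module N = StrictToNonStrict _≈_ _<_
  module RP = RingProperties ring

  <-≤-trans : ∀ {x y z} → x < y → y ≤ z → x < z
  <-≤-trans = N.<-≤-trans O.trans O.<-respʳ-≈

  ≤-<-trans : ∀ {x y z} → x ≤ y → y < z → x < z
  ≤-<-trans = N.≤-<-trans sym O.trans O.<-respˡ-≈

  ≤-trans : ∀ {x y z} → x ≤ y → y ≤ z → x ≤ z
  ≤-trans = N.trans O.isEquivalence O.<-resp-≈ O.trans

  ≤⇒≯ : ∀ {x y} → x ≤ y → ¬ y < x
  ≤⇒≯ x≤y y<x = O.irrefl refl (≤-<-trans x≤y y<x)

  ≮⇒≥ : ∀ {x y} → ¬ x < y → y ≤ x
  ≮⇒≥ {x} {y} x≮y with O.compare x y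
  ... | tri< x<y _ _ = ⊥-elim (x≮y x<y)
  ... | tri≈ _ x≈y _ = inj₂ (sym x≈y)
  ... | tri> _ _ y<x = inj₁ y<x

  ≰⇒> : ∀ {x y} → ¬ x ≤ y → y < x
  ≰⇒> {x} {y} x≰y with O.compare x y
  ... | tri< x<y _ _ = ⊥-elim (x≰y (inj₁ x<y))
  ... | tri≈ _ x≈y _ = ⊥-elim (x≰y (inj₂ x≈y))
  ... | tri> _ _ y<x = y<x

  +-monoˡ-≤ : ∀ {x y} z → x ≤ y → x + z ≤ y + z
  +-monoˡ-≤ z (inj₁ x<y) = inj₁ (+-monoˡ-< z x<y)
  +-monoˡ-≤ z (inj₂ x≈y) = inj₂ (+-congʳ x≈y)

  +-monoʳ-≤ : ∀ {x y} z → x ≤ y → z + x ≤ z + y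
  +-monoʳ-≤ z x≤y =
    ≤-trans (inj₂ (+-comm z _)) (≤-trans (+-monoˡ-≤ z x≤y) (inj₂ (+-comm _ z)))

  x+z-z≈x : ∀ x z → x + z - z ≈ x
  x+z-z≈x x z = trans (+-assoc x z (- z)) (trans (+-congˡ (-‿inverseʳ z)) (+-identityʳ x))

  x-z+z≈x : ∀ x z → x - z + z ≈ x
  x-z+z≈x x z = trans (+-assoc x (- z) z) (trans (+-congˡ (-‿inverseˡ z)) (+-identityʳ x))

  x<x+pos : ∀ x {z} → 0# < z → x < x + z
  x<x+pos x {z} 0<z = O.<-respˡ-≈ (+-identityˡ x) (O.<-respʳ-≈ (+-comm z x) (+-monoˡ-< x 0<z))

  x-pos<x : ∀ x {z} → 0# < z → x - z < x
  x-pos<x x {z} 0<z = O.<-respʳ-≈ (x-z+z≈x x z) (x<x+pos (x - z) 0<z)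

  x<y⇒0<y-x : ∀ {x y} → x < y → 0# < y - x
  x<y⇒0<y-x {x} x<y = O.<-respˡ-≈ (-‿inverseʳ x) (+-monoˡ-< (- x) x<y)

  -‿anti-< : ∀ {x y} → x < y → - y < - x
  -‿anti-< {x} {y} x<y =
    O.<-respˡ-≈ (+-identityˡ (- y)) (O.<-respʳ-≈ eq (+-monoˡ-< (- y) (x<y⇒0<y-x x<y)))
    where
    eq : y - x - y ≈ - x
    eq = trans (+-congʳ (+-comm y (- x))) (x+z-z≈x (- x) y)

  -‿anti-≤ : ∀ {x y} → x ≤ y → - y ≤ - x
  -‿anti-≤ (inj₁ x<y) = inj₁ (-‿anti-< x<y)
  -‿anti-≤ (inj₂ x≈y) = inj₂ (-‿cong (sym x≈y))

  *-monoˡ-< : ∀ {x y} z → 0# < z → x < y → x * z < y * z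
  *-monoˡ-< {x} {y} z 0<z x<y = O.<-respˡ-≈ (+-identityˡ (x * z)) (O.<-respʳ-≈ eq
      (+-monoˡ-< (x * z) (*-pos (x<y⇒0<y-x x<y) 0<z)))
    where
    eq : (y - x) * z + x * z ≈ y * z
    eq = trans (sym (distribʳ z (y - x) x)) (*-congʳ (x-z+z≈x y x))

  *-monoˡ-≤ : ∀ {x y} z → 0# < z → x ≤ y → x * z ≤ y * z
  *-monoˡ-≤ z 0<z (inj₁ x<y) = inj₁ (*-monoˡ-< z 0<z x<y)
  *-monoˡ-≤ z 0<z (inj₂ x≈y) = inj₂ (*-congʳ x≈y)

  *-monoʳ-≤ : ∀ {x y} z → 0# < z → x ≤ y → z * x ≤ z * y
  *-monoʳ-≤ z 0<z x≤y =
    ≤-trans (inj₂ (*-comm z _)) (≤-trans (*-monoˡ-≤ z 0<z x≤y) (inj₂ (*-comm _ z)))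

  pos⇒≉0 : ∀ {x} → 0# < x → x ≉ 0#
  pos⇒≉0 0<x x≈0 = O.irrefl (sym x≈0) 0<x

  ⁻¹-pos : ∀ {x} → 0# < x → 0# < x ⁻¹
  ⁻¹-pos {x} 0<x = ≰⇒> λ x⁻¹≤0 → ≤⇒≯
    (≤-trans (inj₂ (sym (*-inverseʳ x (pos⇒≉0 0<x))))
      (≤-trans (*-monoʳ-≤ x 0<x x⁻¹≤0) (inj₂ (zeroʳ x)))) 0<1

  1<2 : 1# < 2#
  1<2 = x<x+pos 1# 0<1

  0<2 : 0# < 2#
  0<2 = O.trans 0<1 1<2

  ^-pos : ∀ {x} n → 0# < x → 0# < x ^ n
  ^-pos zero    0<x = 0<1
  ^-pos (suc n) 0<x = *-pos 0<x (^-pos n 0<x)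

  2^-mono : ∀ {p q} → p ℕ.≤ q → 2# ^ p ≤ 2# ^ q
  2^-mono {q = zero}  z≤n = inj₂ refl
  2^-mono {q = suc q} z≤n = ≤-trans (2^-mono {q = q} z≤n)
    (≤-trans (inj₂ (sym (*-identityˡ _))) (*-monoˡ-≤ _ (^-pos q 0<2) (inj₁ 1<2)))
  2^-mono (s≤s p≤q) = *-monoʳ-≤ 2# 0<2 (2^-mono p≤q)

  ^-mono-< : ∀ {x y} n → 0# < x → x < y → x ^ suc n < y ^ suc n
  ^-mono-< zero    0<x x<y = O.<-respˡ-≈ (sym (*-identityʳ _))
                               (O.<-respʳ-≈ (sym (*-identityʳ _)) x<y)
  ^-mono-< {x} {y} (suc n) 0<x x<y = O.trans (*-monoˡ-< _ (^-pos (suc n) 0<x) x<y)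
    (O.<-respˡ-≈ (*-comm _ y) (O.<-respʳ-≈ (*-comm _ y)
      (*-monoˡ-< y (O.trans 0<x x<y) (^-mono-< n 0<x x<y))))

  fromℕ-nonneg : ∀ n → 0# ≤ fromℕ n
  fromℕ-nonneg zero    = inj₂ refl
  fromℕ-nonneg (suc n) = ≤-trans (fromℕ-nonneg n)
    (inj₁ (O.<-respʳ-≈ (+-comm _ 1#) (x<x+pos (fromℕ n) 0<1)))

  fromℕ-mono : ∀ {m n} → m ℕ.≤ n → fromℕ m ≤ fromℕ n
  fromℕ-mono {n = n} z≤n = fromℕ-nonneg n
  fromℕ-mono (s≤s m≤n)   = +-monoʳ-≤ 1# (fromℕ-mono m≤n)

  fromℕ-cancel : ∀ {m n} → fromℕ m ≤ fromℕ n → m ℕ.≤ n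
  fromℕ-cancel {m} {n} p = ℕₚ.≮⇒≥ λ n<m → ≤⇒≯ p
    (<-≤-trans (O.<-respʳ-≈ (+-comm _ 1#) (x<x+pos (fromℕ n) 0<1)) (fromℕ-mono n<m))

  fromℤ-mono : ∀ {i j} → i ℤ.≤ j → fromℤ i ≤ fromℤ j
  fromℤ-mono (ℤ.-≤- n≤m) = -‿anti-≤ (fromℕ-mono (s≤s n≤m))
  fromℤ-mono (ℤ.-≤+ {m} {n}) = ≤-trans
    (≤-trans (-‿anti-≤ (fromℕ-nonneg (suc m))) (inj₂ RP.-0#≈0#)) (fromℕ-nonneg n)
  fromℤ-mono (ℤ.+≤+ m≤n) = fromℕ-mono m≤n

  fromℤ-suc : ∀ i → fromℤ (ℤ.suc i) ≈ 1# + fromℤ i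
  fromℤ-suc (+ n) = refl
  fromℤ-suc -[1+ zero ] = sym (trans (+-congˡ (-‿cong (+-identityʳ 1#))) (-‿inverseʳ 1#))
  fromℤ-suc -[1+ suc n ] = sym
    (trans (+-congˡ (sym (RP.-‿+-comm 1# (fromℕ (suc n)))))
      (trans (sym (+-assoc 1# (- 1#) _)) (trans (+-congʳ (-‿inverseʳ 1#)) (+-identityˡ _))))

  -- For t ≥ 0, 2^t is the supremum of the powers 2^(p/q) with 0 ≤ p/q ≤ t,
  -- and 2^(p/q) is the nonnegative x with x^q = 2^p.

  RationalPower : Carrier → Pred Carrier 0ℓ
  RationalPower t x =
    0# ≤ x × ∃[ p ] ∃[ q ] 0 ℕ.< q × fromℕ p ≤ fromℕ q * t × x ^ q ≈ 2# ^ p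

  1∈RationalPower : ∀ {t} → 0# ≤ t → 1# ∈ RationalPower t
  1∈RationalPower {t} 0≤t = inj₁ 0<1 , 0 , 1 , s≤s z≤n
    , ≤-trans 0≤t (inj₂ (sym (trans (*-congʳ (+-identityʳ 1#)) (*-identityˡ t))))
    , *-identityʳ 1#

  opaque
    pow2 : (t : I) → ∃[ θ ] θ ∈ IsSup (RationalPower (proj₁ t))
    pow2 (t , 0≤t , t≤1) =
      sup (RationalPower t) (1# , 1∈RationalPower 0≤t) (2# , 2-bound)
      where
      2-bound : 2# ∈ UpperBound (RationalPower t)
      2-bound x (_ , p , suc q , _ , p≤qt , xq≈2p) = ≮⇒≥ λ 2<x → ≤⇒≯
        (≤-trans (inj₂ xq≈2p) (2^-mono {p} {suc q} (fromℕ-cancel p≤q))) (^-mono-< q 0<2 2<x)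
        where
        p≤q : fromℕ p ≤ fromℕ (suc q)
        p≤q = ≤-trans p≤qt (≤-trans
          (*-monoʳ-≤ _ (<-≤-trans 0<1 (≤-trans (inj₂ (sym (+-identityʳ 1#)))
            (fromℕ-mono (s≤s (z≤n {q}))))) t≤1)
          (inj₂ (*-identityʳ _)))

  2^ : I → Carrier
  2^ t = proj₁ (pow2 t)

  1≤2^ : ∀ t → 1# ≤ 2^ t
  1≤2^ t@(_ , 0≤t , _) = proj₁ (proj₂ (pow2 t)) 1# (1∈RationalPower 0≤t)

  IsUltralimit : ℕ* → (ℕ⁺ → Carrier) → Pred Carrier 0ℓ
  IsUltralimit ω f L = ∀ ε → 0# < ε → ω ∋ λ n → ∣ f n - L ∣< ε

  opaque
    ultralimit : ∀ ω f → (∀ n → 0# ≤ f n × f n ≤ 1#) → ∃[ L ] L ∈ IsUltralimit ω f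
    ultralimit (ω , _) f bounds with
      sup (λ x → (λ n → x ≤ f n) ∈ Large ω)
          (0# , upward ω (λ {n} _ → proj₁ (bounds n)) (universe ω))
          (1# , λ x x∈ → ≮⇒≥ λ 1<x → proper ω
            (upward ω (λ {n} x≤fn → ≤⇒≯ (≤-trans x≤fn (proj₂ (bounds n))) 1<x) x∈))
    ... | L , L-ub , L-least = L , λ ε 0<ε → meet ω (below ε 0<ε) (above ε 0<ε)
      where
      below : ∀ ε → 0# < ε → (λ n → f n < L + ε) ∈ Large ω
      below ε 0<ε with total ω (λ n → f n < L + ε)
      ... | inj₁ p = p
      ... | inj₂ p = ⊥-elim (≤⇒≯ (L-ub (L + ε) (upward ω ≮⇒≥ p)) (x<x+pos L 0<ε))

      above : ∀ ε → 0# < ε → (λ n → L < f n + ε) ∈ Large ω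
      above ε 0<ε with total ω (λ n → L < f n + ε)
      ... | inj₁ p = p
      ... | inj₂ p = ⊥-elim (≤⇒≯ (L-least (L - ε) λ x x∈ → ≮⇒≥ λ L-ε<x → proper ω
          (upward ω (λ {n} (L≮ , x≤) → L≮ (O.<-respˡ-≈ (x-z+z≈x L ε)
            (+-monoˡ-< ε (<-≤-trans L-ε<x x≤)))) (meet ω p x∈)))
        (x-pos<x L 0<ε))

-- The mathematics is classical: excluded middle is assumed throughout.

module Construction (em : ∀ {ℓ} → ExcludedMiddle ℓ) (R : CompleteOrderedField) where

  open OrderedField R public

  opaque
    archimedean : ∀ x → ∃[ n ] x < fromℕ n
    archimedean x with em {P = ∃[ n ] x < fromℕ n}
    ... | yes p = p
    ... | no ¬p with sup (λ y → ∃[ n ] y ≈ fromℕ n) (0# , 0 , refl)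
                         (x , λ { y (n , y≈n) → ≤-trans (inj₂ y≈n) (≮⇒≥ λ x<n → ¬p (n , x<n)) })
    ... | b , b-ub , b-least = ⊥-elim (≤⇒≯ (b-least (b - 1#) b-1-ub) (x-pos<x b 0<1))
      where
      b-1-ub : (b - 1#) ∈ UpperBound (λ y → ∃[ n ] y ≈ fromℕ n)
      b-1-ub y (n , y≈n) = ≤-trans (inj₂ (trans (sym (x+z-z≈x y 1#))
          (+-congʳ (trans (+-comm y 1#) (+-congˡ y≈n)))))
        (+-monoˡ-≤ (- 1#) (b-ub _ (suc n , refl)))

  IsFloor : Carrier → Pred ℤ 0ℓ
  IsFloor x k = fromℤ k ≤ x × (∀ j → fromℤ j ≤ x → j ℤ.≤ k)

  opaque
    floor : ∀ x → ∃[ k ] k ∈ IsFloor x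
    floor x with archimedean (- x)
    ... | m , -x<m with archimedean (x - fromℤ -[1+ m ])
    ...   | d , x-k<d = search d -[1+ m ] start
              (O.<-respˡ-≈ (x-z+z≈x x _) (O.<-respʳ-≈ (+-comm _ _) (+-monoˡ-< _ x-k<d)))
      where
      start : fromℤ -[1+ m ] ≤ x
      start = ≤-trans (-‿anti-≤ (≤-trans (inj₁ -x<m) (fromℕ-mono (ℕₚ.n≤1+n m))))
                (inj₂ (RP.-‿involutive x))

      search : ∀ d k → fromℤ k ≤ x → x < fromℤ k + fromℕ d → ∃[ k ] k ∈ IsFloor x
      search zero    k k≤x x<k+d = ⊥-elim (≤⇒≯ k≤x (O.<-respʳ-≈ (+-identityʳ _) x<k+d))
      search (suc d) k k≤x x<k+d with x O.<? fromℤ (ℤ.suc k)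
      ... | yes x<k+1 = k , k≤x , λ j j≤x → ℤₚ.≮⇒≥ λ k<j →
              ≤⇒≯ (≤-trans (fromℤ-mono (ℤₚ.i<j⇒suc[i]≤j k<j)) j≤x) x<k+1
      ... | no  x≮k+1 = search d (ℤ.suc k) (≮⇒≥ x≮k+1) (O.<-respʳ-≈ eq x<k+d)
        where
        eq : fromℤ k + (1# + fromℕ d) ≈ fromℤ (ℤ.suc k) + fromℕ d
        eq = trans (sym (+-assoc _ 1# _))
               (+-congʳ (trans (+-comm _ 1#) (sym (fromℤ-suc k))))

  ⌊_⌋ : Carrier → ℤ
  ⌊ x ⌋ = proj₁ (floor x)

  frac : Carrier → I
  frac x = x - fromℤ ⌊ x ⌋ , 0≤ , inj₁ <1
    where
    0≤ : 0# ≤ x - fromℤ ⌊ x ⌋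
    0≤ = ≤-trans (inj₂ (sym (-‿inverseʳ _))) (+-monoˡ-≤ _ (proj₁ (proj₂ (floor x))))

    x<1+⌊x⌋ : x < 1# + fromℤ ⌊ x ⌋
    x<1+⌊x⌋ = ≰⇒> λ p → ℤₚ.<-irrefl ≡.refl (ℤₚ.suc[i]≤j⇒i<j
      (proj₂ (proj₂ (floor x)) (ℤ.suc ⌊ x ⌋) (≤-trans (inj₂ (fromℤ-suc ⌊ x ⌋)) p)))

    <1 : x - fromℤ ⌊ x ⌋ < 1#
    <1 = O.<-respʳ-≈ (x+z-z≈x 1# _) (+-monoˡ-< _ x<1+⌊x⌋)

  ∣⌊⌋∣≤ : ∀ {x} → 0# ≤ x → fromℕ ℤ.∣ ⌊ x ⌋ ∣ ≤ x
  ∣⌊⌋∣≤ {x} 0≤x with floor x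
  ... | + n      , n≤x , _       = n≤x
  ... | -[1+ n ] , _   , largest with () ← largest (+ 0) 0≤x

  -- Ω* is the setoid of points of ℕ* × [0,1] modulo _∼_.

  Ω* : Set₁
  Ω* = ℕ* × I

  data Glue : Rel Ω* (lsuc 0ℓ) where
    equal : ∀ {ω ω′ t t′} → ω ≈ᵤ ω′ → proj₁ t ≈ proj₁ t′ → Glue (ω , t) (ω′ , t′)
    glue  : ∀ {ω ω′ t t′} → proj₁ t ≈ 1# → ω′ ≈ᵤ τ ω → proj₁ t′ ≈ 0# → Glue (ω , t) (ω′ , t′)

  infix 4 _∼_

  _∼_ : Rel Ω* (lsuc 0ℓ)
  _∼_ = EqClosure Glue

  -- A subset of the quotient is a ∼-saturated predicate; it is open when its
  -- preimage is open for the product topology, the sets {ω | A ∈ ω} being the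
  -- basic open subsets of ℕ*.  Excluded middle makes every predicate equivalent
  -- to one at level 0ℓ.

  record Open (V : Pred Ω* 0ℓ) : Set₁ where
    field
      saturated : V Respects _∼_
      open-nbhd : ∀ {ω t} → (ω , t) ∈ V →
        ∃[ A ] ∃[ ε ] ω ∋ A × 0# < ε ×
        (∀ ω′ t′ → ω′ ∋ A → ∣ proj₁ t′ - proj₁ t ∣< ε → (ω′ , t′) ∈ V)

  closure : Pred Ω* (lsuc 0ℓ) → Pred Ω* (lsuc 0ℓ)
  closure S η = ∀ V → Open V → η ∈ V → S ≬ V

  φ : Carrier → Ω* → Ω*
  φ s (ω , t , _) = τ^ ⌊ t + s ⌋ ω , frac (t + s)

  o₋ : Ω* → Pred Ω* (lsuc 0ℓ)
  o₋ η ζ = ∃[ s ] 0# ≤ s × ζ ∼ φ (- s) η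

  -- |A ∩ {1,…,m}|

  count : 𝒫ℕ⁺ → ℕ → ℕ
  count A m = length (filter (λ n → em {P = n ∈ A}) (applyUpTo [1+_] m))

  -- The absolute value only turns the nonnegative integer [θ·2ⁿ] into a natural.

  density : I → 𝒫ℕ⁺ → ℕ⁺ → Carrier
  density t A n = fromℕ (count A ℤ.∣ ⌊ x ⌋ ∣) * x ⁻¹
    where
    x = 2^ t * 2# ^ toℕ n

  density-bounds : ∀ t A n → 0# ≤ density t A n × density t A n ≤ 1#
  density-bounds t A n =
      ≤-trans (inj₂ (sym (zeroˡ _))) (*-monoˡ-≤ _ (⁻¹-pos 0<x) (fromℕ-nonneg (count A m)))
    , ≤-trans (*-monoˡ-≤ _ (⁻¹-pos 0<x) (≤-trans (fromℕ-mono {count A m} {m} count≤) (∣⌊⌋∣≤ (inj₁ 0<x))))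
              (inj₂ (*-inverseʳ x (pos⇒≉0 0<x)))
    where
    x = 2^ t * 2# ^ toℕ n

    0<x : 0# < x
    0<x = *-pos (<-≤-trans 0<1 (1≤2^ t)) (^-pos (toℕ n) 0<2)

    m = ℤ.∣ ⌊ x ⌋ ∣

    count≤ : count A m ℕ.≤ m
    count≤ = ℕₚ.≤-trans (length-filter _ (applyUpTo [1+_] m))
               (ℕₚ.≤-reflexive (length-applyUpTo [1+_] m))

  ν : Ω* → 𝒫ℕ⁺ → Carrier
  ν (ω , t) A = proj₁ (ultralimit ω (density t A) (density-bounds t A))

  infix 4 _≺_

  _≺_ : Rel (𝒫ℕ⁺ → Carrier) (lsuc 0ℓ)
  ν₁ ≺ ν₂ = ∀ A → ν₂ A ≈ 0# → ν₁ A ≈ 0#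

{-# OPTIONS --safe #-}
module Submission where

open import Defs
open import Axiom.ExcludedMiddle using (ExcludedMiddle)
open import Function.Bundles using (_⇔_)
open import Relation.Unary using (_∈_)

open import Algebra.Bundles using (CommutativeRing)
import Algebra.Properties.CommutativeSemiring.Exp as CommExp
import Algebra.Properties.Ring as RingProperties
import Algebra.Properties.Semiring.Exp as Exp
import Algebra.Properties.Semiring.Mult as Mult
import Algebra.Properties.Semiring.Mult.TCOptimised as MultTC
import Algebra.Solver.Ring as RingSolver
open import Algebra.Solver.Ring.AlmostCommutativeRing
  using (fromCommutativeRing; _-Raw-AlmostCommutative⟶_)
open import Data.Empty using (⊥-elim)
open import Data.Integer.Base as ℤ using (ℤ; +_; -[1+_])
import Data.Integer.Properties as ℤₚ
open import Data.List.Base using (length; filter; applyUpTo; _∷_; [])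
open import Data.List.Properties
  using (length-filter; length-applyUpTo; applyUpTo-∷ʳ; filter-++; length-++; filter-accept; filter-reject)
open import Data.Maybe.Base using (just; nothing)
open import Data.Nat.Base as ℕ using (ℕ; zero; suc; z≤n; s≤s)
open import Data.Nat.GeneralisedArithmetic using (fold)
import Data.Nat.Properties as ℕₚ
open import Data.Product.Base using (∃-syntax; Σ-syntax; _×_; _,_; proj₁; proj₂)
open import Data.Sum.Base using (_⊎_; inj₁; inj₂)
open import Function.Base using (_∘_; case_of_; id)
open import Function.Bundles using (mk⇔)
open import Relation.Binary.Bundles using (StrictPartialOrder)
import Relation.Binary.Construct.Closure.Equivalence as EqClosure
open import Relation.Binary.Construct.Closure.ReflexiveTransitive using (_◅_) renaming (ε to [])
open import Relation.Binary.Construct.Closure.Symmetric using (fwd; bwd)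
open import Relation.Binary.Definitions using (tri<; tri≈; tri>; WeaklyDecidable)
open import Relation.Binary.PropositionalEquality.Core as ≡ using (_≡_)
import Relation.Binary.Reasoning.Setoid as SetoidReasoning
import Relation.Binary.Reasoning.StrictPartialOrder as StrictReasoning
open import Relation.Nullary.Decidable.Core using (yes; no)
open import Relation.Nullary.Negation.Core using (¬_)
open import Relation.Unary using (Pred; _∉_; _≬_)

open ℕ⁺ using (pred)

-- Write x_n = 2^t·2^n for the scale of η = (ω , t) at n.  Then ν_η(A) = 0 says
-- that for every ε > 0 and ω-almost every n the interval [1, x_n] contains
-- fewer than ε·x_n elements of A.
--
-- Moving backwards along the orbit of η shrinks the scale by a bounded factor,
-- so A remains null along o₋(η); and {ζ | ν_ζ(A) ≠ 0} is open, because 2^t is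
-- continuous in t.  Hence A is null on the whole closure of o₋(η).
--
-- Conversely, suppose that an open V ∋ η′ = (ω′ , t′) misses o₋(η); by the
-- gluing we may take t′ > 0.  Then V contains every (ω″ , u) with B ∈ ω″ and u
-- in a left neighbourhood (t₁ , t′], for some B ∈ ω′.  Let A be the union over
-- j ∈ B of the blocks (2^t₁·2^j , 2^t′·2^j].  Each block carries a fixed
-- proportion of [1, 2^t′·2^j], so ν_η′(A) > 0.  A block of index j = n - i that
-- meets [1, x_n] for ω-almost every n would put (τ⁻ⁱω , t′), or (ω , t) itself,
-- into V ∩ o₋(η).  So for each K the elements of A below x_n lie, for ω-almost
-- every n, below 2^(n-K+1), and ν_η(A) = 0.

-- A ring solver with integer coefficients for commutative rings.

module IntegerCoefficients {c ℓ} (R : CommutativeRing c ℓ) where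

  open CommutativeRing R hiding (zero)
  open RingProperties ring
  open MultTC semiring renaming (_×_ to _·_)

  -- The optimised multiples send 1 and 2 to `1#` and `1# + 1#`, with no trailing zero summand, so
  -- solver constants agree with `1#` and `2#` on the nose.
  fromℤ′ : ℤ → Carrier
  fromℤ′ (+ n)    = n · 1#
  fromℤ′ -[1+ n ] = - (suc n · 1#)

  open SetoidReasoning setoid

  private
    cancel : ∀ x y z → (x + y) - (x + z) ≈ y - z
    cancel x y z = begin
      (x + y) - (x + z)     ≈⟨ +-cong (+-comm x y) (sym (-‿+-comm x z)) ⟩
      (y + x) + (- x - z)   ≈⟨ +-assoc y x _ ⟩
      y + (x + (- x - z))   ≈⟨ +-congˡ (+-assoc x (- x) (- z)) ⟨
      y + ((x - x) - z)     ≈⟨ +-congˡ (trans (+-congʳ (-‿inverseʳ x)) (+-identityˡ _)) ⟩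
      y - z                 ∎

  ⊖-homo : ∀ m n → fromℤ′ (m ℤ.⊖ n) ≈ m · 1# - n · 1#
  ⊖-homo m       zero    = sym (trans (+-congˡ -0#≈0#) (+-identityʳ _))
  ⊖-homo zero    (suc n) = sym (+-identityˡ _)
  ⊖-homo (suc m) (suc n) = begin
    fromℤ′ (suc m ℤ.⊖ suc n)       ≡⟨ ≡.cong fromℤ′ (ℤₚ.[1+m]⊖[1+n]≡m⊖n m n) ⟩
    fromℤ′ (m ℤ.⊖ n)               ≈⟨ ⊖-homo m n ⟩
    m · 1# - n · 1#                ≈⟨ cancel 1# _ _ ⟨
    (1# + m · 1#) - (1# + n · 1#)  ≈⟨ +-cong (1+× m 1#) (-‿cong (1+× n 1#)) ⟨
    suc m · 1# - suc n · 1#        ∎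

  neg-homo : ∀ i → fromℤ′ (ℤ.- i) ≈ - fromℤ′ i
  neg-homo (+ zero)  = sym -0#≈0#
  neg-homo (+ suc n) = refl
  neg-homo -[1+ n ]  = sym (-‿involutive _)

  +-homo : ∀ i j → fromℤ′ (i ℤ.+ j) ≈ fromℤ′ i + fromℤ′ j
  +-homo (+ m)    (+ n)    = ×-homo-+ 1# m n
  +-homo (+ m)    -[1+ n ] = ⊖-homo m (suc n)
  +-homo -[1+ m ] (+ n)    = trans (⊖-homo n (suc m)) (+-comm _ _)
  +-homo -[1+ m ] -[1+ n ] = begin
    - (suc (suc (m ℕ.+ n)) · 1#)       ≡⟨ ≡.cong (λ k → - (suc k · 1#)) (ℕₚ.+-suc m n) ⟨
    - ((suc m ℕ.+ suc n) · 1#)         ≈⟨ -‿cong (×-homo-+ 1# (suc m) (suc n)) ⟩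
    - (suc m · 1# + suc n · 1#)        ≈⟨ -‿+-comm _ _ ⟨
    - (suc m · 1#) + - (suc n · 1#)    ∎

  *-homo⁺ : ∀ m j → fromℤ′ (+ m ℤ.* j) ≈ fromℤ′ (+ m) * fromℤ′ j
  *-homo⁺ m (+ n) = begin
    fromℤ′ (+ m ℤ.* + n)     ≡⟨ ≡.cong fromℤ′ (ℤₚ.pos-* m n) ⟨
    (m ℕ.* n) · 1#           ≈⟨ ×1-homo-* m n ⟩
    (m · 1#) * (n · 1#)      ∎
  *-homo⁺ m -[1+ n ] = begin
    fromℤ′ (+ m ℤ.* (ℤ.- + suc n))    ≡⟨ ≡.cong fromℤ′ (ℤₚ.neg-distribʳ-* (+ m) (+ suc n)) ⟨
    fromℤ′ (ℤ.- (+ m ℤ.* + suc n))    ≈⟨ neg-homo (+ m ℤ.* + suc n) ⟩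
    - fromℤ′ (+ m ℤ.* + suc n)        ≈⟨ -‿cong (*-homo⁺ m (+ suc n)) ⟩
    - ((m · 1#) * (suc n · 1#))       ≈⟨ -‿distribʳ-* _ _ ⟩
    (m · 1#) * - (suc n · 1#)         ∎

  *-homo : ∀ i j → fromℤ′ (i ℤ.* j) ≈ fromℤ′ i * fromℤ′ j
  *-homo (+ m)    j = *-homo⁺ m j
  *-homo -[1+ m ] j = begin
    fromℤ′ (ℤ.- + suc m ℤ.* j)    ≡⟨ ≡.cong fromℤ′ (ℤₚ.neg-distribˡ-* (+ suc m) j) ⟨
    fromℤ′ (ℤ.- (+ suc m ℤ.* j))  ≈⟨ neg-homo (+ suc m ℤ.* j) ⟩
    - fromℤ′ (+ suc m ℤ.* j)      ≈⟨ -‿cong (*-homo⁺ (suc m) j) ⟩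
    - ((suc m · 1#) * fromℤ′ j)   ≈⟨ -‿distribˡ-* _ _ ⟩
    - (suc m · 1#) * fromℤ′ j     ∎

  morphism : ℤ.+-*-rawRing -Raw-AlmostCommutative⟶ fromCommutativeRing R
  morphism = record
    { ⟦_⟧    = fromℤ′
    ; +-homo = +-homo
    ; *-homo = *-homo
    ; -‿homo = neg-homo
    ; 0-homo = refl
    ; 1-homo = refl
    }

  coeff≟ : WeaklyDecidable (λ i j → fromℤ′ i ≈ fromℤ′ j)
  coeff≟ i j with i ℤₚ.≟ j
  ... | yes ≡.refl = just refl
  ... | no _       = nothing

  open RingSolver ℤ.+-*-rawRing (fromCommutativeRing R) morphism coeff≟ public

-- Inequalities in a complete ordered field; square roots and roots of 2.

module OrderedFieldProperties (R : CompleteOrderedField) where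

  open OrderedField R hiding (zero)
  open IntegerCoefficients commutativeRing using (solve; _:=_; con; _:+_; _:*_; _:-_; :-_) public
  open Exp semiring using (^-congˡ; ^-homo-*; ^-assocʳ) public
  open CommExp commutativeSemiring using (^-distrib-*) public
  open Mult semiring using (×-homo-+; ×1-homo-*) public

  strictPartialOrder : StrictPartialOrder _ _ _
  strictPartialOrder = record { isStrictPartialOrder = O.isStrictPartialOrder }

  module ≤-Reasoning = StrictReasoning strictPartialOrder
  open ≤-Reasoning

  ≤-refl : ∀ {x} → x ≤ x
  ≤-refl = inj₂ refl

  0≤1 : 0# ≤ 1#
  0≤1 = inj₁ 0<1

  +-mono-≤ : ∀ {a b c d} → a ≤ b → c ≤ d → a + c ≤ b + d
  +-mono-≤ a≤b c≤d = ≤-trans (+-monoˡ-≤ _ a≤b) (+-monoʳ-≤ _ c≤d)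

  +-monoʳ-< : ∀ {x y} z → x < y → z + x < z + y
  +-monoʳ-< {x} {y} z x<y = begin-strict
    z + x ≈⟨ +-comm z x ⟩
    x + z <⟨ +-monoˡ-< z x<y ⟩
    y + z ≈⟨ +-comm y z ⟩
    z + y ∎

  +-cancelʳ-≤ : ∀ {x y} z → x + z ≤ y + z → x ≤ y
  +-cancelʳ-≤ z p = ≮⇒≥ λ y<x → ≤⇒≯ p (+-monoˡ-< z y<x)

  x≤x+nonneg : ∀ x {z} → 0# ≤ z → x ≤ x + z
  x≤x+nonneg x {z} 0≤z = begin
    x      ≈⟨ +-identityʳ x ⟨
    x + 0# ≤⟨ +-monoʳ-≤ x 0≤z ⟩
    x + z  ∎

  +-nonneg : ∀ {x y} → 0# ≤ x → 0# ≤ y → 0# ≤ x + y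
  +-nonneg 0≤x 0≤y = ≤-trans 0≤x (x≤x+nonneg _ 0≤y)

  +-pos-nonneg : ∀ {x y} → 0# < x → 0# ≤ y → 0# < x + y
  +-pos-nonneg 0<x 0≤y = <-≤-trans 0<x (x≤x+nonneg _ 0≤y)

  x≤y⇒0≤y-x : ∀ {x y} → x ≤ y → 0# ≤ y - x
  x≤y⇒0≤y-x {x} {y} x≤y = begin
    0#    ≈⟨ -‿inverseʳ x ⟨
    x - x ≤⟨ +-monoˡ-≤ (- x) x≤y ⟩
    y - x ∎

  *-monoˡ-≤-nonneg : ∀ {x y z} → 0# ≤ z → x ≤ y → x * z ≤ y * z
  *-monoˡ-≤-nonneg (inj₁ 0<z) x≤y = *-monoˡ-≤ _ 0<z x≤y
  *-monoˡ-≤-nonneg {x} {y} {z} (inj₂ 0≈z) _ = inj₂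
    (trans (*-congˡ (sym 0≈z)) (trans (zeroʳ x) (trans (sym (zeroʳ y)) (*-congˡ 0≈z))))

  *-monoʳ-≤-nonneg : ∀ {x y z} → 0# ≤ z → x ≤ y → z * x ≤ z * y
  *-monoʳ-≤-nonneg {x} {y} {z} 0≤z x≤y = begin
    z * x ≈⟨ *-comm z x ⟩
    x * z ≤⟨ *-monoˡ-≤-nonneg 0≤z x≤y ⟩
    y * z ≈⟨ *-comm y z ⟩
    z * y ∎

  *-monoʳ-< : ∀ {x y} z → 0# < z → x < y → z * x < z * y
  *-monoʳ-< {x} {y} z 0<z x<y = begin-strict
    z * x ≈⟨ *-comm z x ⟩
    x * z <⟨ *-monoˡ-< z 0<z x<y ⟩
    y * z ≈⟨ *-comm y z ⟩
    z * y ∎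

  *-nonneg : ∀ {x y} → 0# ≤ x → 0# ≤ y → 0# ≤ x * y
  *-nonneg {x} {y} 0≤x 0≤y = begin
    0#     ≈⟨ zeroˡ y ⟨
    0# * y ≤⟨ *-monoˡ-≤-nonneg 0≤y 0≤x ⟩
    x * y  ∎

  *-cancelʳ-≤ : ∀ {x y z} → 0# < z → x * z ≤ y * z → x ≤ y
  *-cancelʳ-≤ 0<z p = ≮⇒≥ λ y<x → ≤⇒≯ p (*-monoˡ-< _ 0<z y<x)

  *-cancelʳ-< : ∀ {x y z} → 0# < z → x * z < y * z → x < y
  *-cancelʳ-< 0<z p = ≰⇒> λ y≤x → ≤⇒≯ (*-monoˡ-≤ _ 0<z y≤x) p

  x*y⁻¹*y≈x : ∀ x {y} → 0# < y → x * y ⁻¹ * y ≈ x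
  x*y⁻¹*y≈x x {y} 0<y = begin-equality
    x * y ⁻¹ * y   ≈⟨ *-assoc x _ y ⟩
    x * (y ⁻¹ * y) ≈⟨ *-congˡ (*-comm _ y) ⟩
    x * (y * y ⁻¹) ≈⟨ *-congˡ (*-inverseʳ y (pos⇒≉0 0<y)) ⟩
    x * 1#         ≈⟨ *-identityʳ x ⟩
    x              ∎

  ^-nonneg : ∀ {x} n → 0# ≤ x → 0# ≤ x ^ n
  ^-nonneg zero    0≤x = 0≤1
  ^-nonneg (suc n) 0≤x = *-nonneg 0≤x (^-nonneg n 0≤x)

  ^-cancel-≤ : ∀ {x y n} → 0 ℕ.< n → 0# ≤ y → x ^ n ≤ y ^ n → x ≤ y
  ^-cancel-≤ {n = suc n} _ (inj₁ 0<y) p = ≮⇒≥ λ y<x → ≤⇒≯ p (^-mono-< n 0<y y<x)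
  ^-cancel-≤ {n = suc n} _ (inj₂ 0≈y) p = ≮⇒≥ λ y<x → ≤⇒≯ p
    (O.<-respˡ-≈ (trans (sym (zeroˡ _)) (*-congʳ 0≈y)) (^-pos (suc n) (O.<-respˡ-≈ (sym 0≈y) y<x)))

  1^n≈1 : ∀ n → 1# ^ n ≈ 1#
  1^n≈1 zero    = refl
  1^n≈1 (suc n) = trans (*-identityˡ _) (1^n≈1 n)

  -- e (2 + e) = d says that 1 + e is the square root of 1 + d.

  sqrt[1+_] : ∀ d → 0# < d → ∃[ e ] 0# < e × e * (2# + e) ≈ d
  sqrt[1+ d ] 0<d with sup S (0# , 0∈S) (d , d-bound)
    where
    S : Pred Carrier _
    S x = 0# ≤ x × x * (2# + x) ≤ d

    0∈S : 0# ∈ S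
    0∈S = ≤-refl , ≤-trans (inj₂ (zeroˡ _)) (inj₁ 0<d)

    d-bound : d ∈ UpperBound S
    d-bound x (0≤x , p) = begin
      x            ≈⟨ *-identityʳ x ⟨
      x * 1#       ≤⟨ *-monoʳ-≤-nonneg 0≤x (≤-trans (inj₁ 1<2) (x≤x+nonneg 2# 0≤x)) ⟩
      x * (2# + x) ≤⟨ p ⟩
      d            ∎
  ... | s , s-ub , s-least = s , 0<s , s[2+s]≈d
    where
    0≤s : 0# ≤ s
    0≤s = s-ub 0# (≤-refl , ≤-trans (inj₂ (zeroˡ _)) (inj₁ 0<d))

    not-below : ¬ s * (2# + s) < d
    not-below below = ≤⇒≯ (s-ub (s + h) (+-nonneg 0≤s (inj₁ 0<h) , (begin
        (s + h) * (2# + (s + h))                 ≈⟨ solve 2 (λ s h → (s :+ h) :* (con (+ 2) :+ (s :+ h))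
                                                      := s :* (con (+ 2) :+ s) :+ h :* (con (+ 2) :+ s :+ s :+ h)) refl s h ⟩
        s * (2# + s) + h * (2# + s + s + h)      ≤⟨ +-monoʳ-≤ _ (*-monoʳ-≤ h 0<h
                                                      (+-monoʳ-≤ _ (≤-trans h≤1 (x≤x+nonneg 1# (inj₁ 0<g))))) ⟩
        s * (2# + s) + h * K                     ≈⟨ +-congˡ (x*y⁻¹*y≈x g 0<K) ⟩
        s * (2# + s) + (d - s * (2# + s))        ≈⟨ solve 2 (λ u d → u :+ (d :- u) := d) refl _ d ⟩
        d                                        ∎)))
      (x<x+pos s 0<h)
      where
      -- Replacing s by s + h adds h(2 + 2s + h) to s(2 + s). The summand g in K forces h ≤ 1, so K
      -- bounds the second factor and the increase is at most hK = g.
      g = d - s * (2# + s)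
      K = 2# + s + s + (1# + g)
      h = g * K ⁻¹

      0<g : 0# < g
      0<g = x<y⇒0<y-x below

      0<K : 0# < K
      0<K = +-pos-nonneg (+-pos-nonneg (+-pos-nonneg 0<2 0≤s) 0≤s) (+-nonneg 0≤1 (inj₁ 0<g))

      0<h : 0# < h
      0<h = *-pos 0<g (⁻¹-pos 0<K)

      h≤1 : h ≤ 1#
      h≤1 = *-cancelʳ-≤ 0<K (begin
        h * K                       ≈⟨ x*y⁻¹*y≈x g 0<K ⟩
        g                           ≤⟨ x≤x+nonneg g (+-nonneg (+-nonneg (+-nonneg (inj₁ 0<2) 0≤s) 0≤s) 0≤1) ⟩
        g + (2# + s + s + 1#)       ≈⟨ solve 2 (λ s g → g :+ (con (+ 2) :+ s :+ s :+ con (+ 1))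
                                         := con (+ 1) :* (con (+ 2) :+ s :+ s :+ (con (+ 1) :+ g))) refl s g ⟩
        1# * K                      ∎)

    not-above : ¬ d < s * (2# + s)
    not-above above = ≤⇒≯ (s-least (s - h) λ x x∈S → ≮⇒≥ (λ s-h<x → too-close x x∈S s-h<x)) (x-pos<x s 0<h)
      where
      -- For x in (s - h , s] the drop from s(2 + s) to x(2 + x) is (s - x)(2 + s + x), less than hK
      -- = g. So no such x lies in S, and s - h is a smaller upper bound.
      g = s * (2# + s) - d
      K = 2# + s + s
      h = g * K ⁻¹

      0<K : 0# < K
      0<K = +-pos-nonneg (+-pos-nonneg 0<2 0≤s) 0≤s

      0<h : 0# < h
      0<h = *-pos (x<y⇒0<y-x above) (⁻¹-pos 0<K)

      too-close : ∀ x → 0# ≤ x × x * (2# + x) ≤ d → ¬ s - h < x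
      too-close x (0≤x , p) s-h<x = O.irrefl refl (begin-strict
        s * (2# + s)                              ≈⟨ solve 2 (λ s x → s :* (con (+ 2) :+ s)
                                                       := x :* (con (+ 2) :+ x) :+ (s :- x) :* (con (+ 2) :+ s :+ x)) refl s x ⟩
        x * (2# + x) + (s - x) * (2# + s + x)     ≤⟨ +-mono-≤ p (*-monoʳ-≤-nonneg (x≤y⇒0≤y-x x≤s) (+-monoʳ-≤ _ x≤s)) ⟩
        d + (s - x) * K                           <⟨ +-monoʳ-< d (*-monoˡ-< K 0<K s-x<h) ⟩
        d + h * K                                 ≈⟨ +-congˡ (x*y⁻¹*y≈x g 0<K) ⟩
        d + (s * (2# + s) - d)                    ≈⟨ solve 2 (λ u d → d :+ (u :- d) := u) refl _ d ⟩
        s * (2# + s)                              ∎)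
        where
        x≤s : x ≤ s
        x≤s = s-ub x (0≤x , p)

        s-x<h : s - x < h
        s-x<h = begin-strict
          s - x                 ≈⟨ solve 3 (λ s x h → s :- x := s :- h :+ (h :- x)) refl s x h ⟩
          s - h + (h - x)       <⟨ +-monoˡ-< (h - x) s-h<x ⟩
          x + (h - x)           ≈⟨ solve 2 (λ x h → x :+ (h :- x) := h) refl x h ⟩
          h                     ∎

    s[2+s]≈d : s * (2# + s) ≈ d
    s[2+s]≈d with O.compare (s * (2# + s)) d
    ... | tri< below _ _ = ⊥-elim (not-below below)
    ... | tri≈ _ eq _    = eq
    ... | tri> _ _ above = ⊥-elim (not-above above)

    0<s : 0# < s
    0<s with 0≤s
    ... | inj₁ 0<s = 0<s
    ... | inj₂ 0≈s = ⊥-elim (pos⇒≉0 0<d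
      (trans (sym s[2+s]≈d) (trans (*-congʳ (sym 0≈s)) (zeroˡ _))))

  -- Start from 2 = 1 + 1 and take square roots k times. Each root satisfies e(2 + e) = d, hence 2e
  -- ≤ d, and this halving is what preserves the bound on d while the exponent doubles.
  2^-root : ∀ k → ∃[ d ] 0# < d × fromℕ (2 ℕ.^ k) * d ≤ 1# × (1# + d) ^ (2 ℕ.^ k) ≈ 2#
  2^-root zero    = 1# , 0<1 , inj₂ (trans (*-identityʳ _) (+-identityʳ 1#)) , *-identityʳ 2#
  2^-root (suc k) =
    let d , 0<d , Nd≤1 , root = 2^-root k
        e , 0<e , eq          = sqrt[1+ d ] 0<d
        N                     = 2 ℕ.^ k
    in e , 0<e
    , (begin
        fromℕ (2 ℕ.* N) * e          ≈⟨ *-congʳ (×1-homo-* 2 N) ⟩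
        fromℕ 2 * fromℕ N * e        ≈⟨ solve 2 (λ n e → (con (+ 1) :+ (con (+ 1) :+ con (+ 0))) :* n :* e
                                          := n :* (e :* con (+ 2))) refl (fromℕ N) e ⟩
        fromℕ N * (e * 2#)           ≤⟨ *-monoʳ-≤-nonneg (fromℕ-nonneg N) (*-monoʳ-≤ e 0<e (x≤x+nonneg 2# (inj₁ 0<e))) ⟩
        fromℕ N * (e * (2# + e))     ≈⟨ *-congˡ eq ⟩
        fromℕ N * d                  ≤⟨ Nd≤1 ⟩
        1#                           ∎)
    , (begin-equality
        (1# + e) ^ (2 ℕ.* N)         ≈⟨ ^-assocʳ (1# + e) 2 N ⟨
        ((1# + e) ^ 2) ^ N           ≈⟨ ^-congˡ N (solve 1 (λ e → (con (+ 1) :+ e) :* ((con (+ 1) :+ e) :* con (+ 1))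
                                          := con (+ 1) :+ e :* (con (+ 2) :+ e)) refl e) ⟩
        (1# + e * (2# + e)) ^ N      ≈⟨ ^-congˡ N (+-congˡ eq) ⟩
        (1# + d) ^ N                 ≈⟨ root ⟩
        2#                           ∎)

-- The function 2^t on [0,1]: monotonicity, endpoint values, steps of rational length.

module PowersOfTwo (R : CompleteOrderedField) where

  open OrderedField R hiding (zero)
  open OrderedFieldProperties R
  open ≤-Reasoning

  ≤-antisym : ∀ {x y} → x ≤ y → y ≤ x → x ≈ y
  ≤-antisym (inj₂ x≈y) _   = x≈y
  ≤-antisym (inj₁ x<y) y≤x = ⊥-elim (≤⇒≯ y≤x x<y)

  *-cancelʳ-≈ : ∀ {x y z} → 0# < z → x * z ≈ y * z → x ≈ y
  *-cancelʳ-≈ 0<z eq = ≤-antisym (*-cancelʳ-≤ 0<z (inj₂ eq)) (*-cancelʳ-≤ 0<z (inj₂ (sym eq)))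

  fromℕ-+ : ∀ m n → fromℕ (m ℕ.+ n) ≈ fromℕ m + fromℕ n
  fromℕ-+ = ×-homo-+ 1#

  fromℕ-pos : ∀ {n} → 0 ℕ.< n → 0# < fromℕ n
  fromℕ-pos 0<n = <-≤-trans (O.<-respʳ-≈ (sym (+-identityʳ 1#)) 0<1) (fromℕ-mono 0<n)

  2^-upper : ∀ t {y} → y ∈ RationalPower (proj₁ t) → y ≤ 2^ t
  2^-upper t = proj₁ (proj₂ (pow2 t)) _

  2^-least : ∀ t {c} → (∀ y → y ∈ RationalPower (proj₁ t) → y ≤ c) → 2^ t ≤ c
  2^-least t = proj₂ (proj₂ (pow2 t)) _

  2^-monotone : ∀ t t′ → proj₁ t ≤ proj₁ t′ → 2^ t ≤ 2^ t′
  2^-monotone t t′ t≤t′ = 2^-least t λ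
    { y (0≤y , p , q , 0<q , p≤qt , eq) → 2^-upper t′
        (0≤y , p , q , 0<q , ≤-trans p≤qt (*-monoʳ-≤-nonneg (fromℕ-nonneg q) t≤t′) , eq) }

  2^-cong : ∀ t t′ → proj₁ t ≈ proj₁ t′ → 2^ t ≈ 2^ t′
  2^-cong t t′ t≈t′ = ≤-antisym (2^-monotone t t′ (inj₂ t≈t′)) (2^-monotone t′ t (inj₂ (sym t≈t′)))

  2^≤2 : ∀ t → 2^ t ≤ 2#
  2^≤2 t@(t₀ , _ , t≤1) = 2^-least t λ
    { y (0≤y , p , q , 0<q , p≤qt , eq) → ^-cancel-≤ 0<q (inj₁ 0<2) (begin
        y ^ q  ≈⟨ eq ⟩
        2# ^ p ≤⟨ 2^-mono (fromℕ-cancel {p} {q} (begin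
                    fromℕ p      ≤⟨ p≤qt ⟩
                    fromℕ q * t₀ ≤⟨ *-monoʳ-≤-nonneg (fromℕ-nonneg q) t≤1 ⟩
                    fromℕ q * 1# ≈⟨ *-identityʳ _ ⟩
                    fromℕ q      ∎)) ⟩
        2# ^ q ∎) }

  2^0≈1 : ∀ t → proj₁ t ≈ 0# → 2^ t ≈ 1#
  2^0≈1 t t≈0 = ≤-antisym
    (2^-least t λ
      { y (0≤y , p , q , 0<q , p≤qt , eq) → ^-cancel-≤ 0<q 0≤1 (begin
          y ^ q  ≈⟨ eq ⟩
          2# ^ p ≤⟨ 2^-mono (fromℕ-cancel {p} {0} (begin
                      fromℕ p           ≤⟨ p≤qt ⟩
                      fromℕ q * proj₁ t ≈⟨ *-congˡ t≈0 ⟩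
                      fromℕ q * 0#      ≈⟨ zeroʳ _ ⟩
                      0#                ∎)) ⟩
          1#     ≈⟨ 1^n≈1 q ⟨
          1# ^ q ∎) })
    (1≤2^ t)

  2^1≈2 : ∀ t → proj₁ t ≈ 1# → 2^ t ≈ 2#
  2^1≈2 t t≈1 = ≤-antisym (2^≤2 t) (2^-upper t
    (inj₁ 0<2 , 1 , 1 , s≤s z≤n , inj₂ (sym (trans (*-congˡ t≈1) (*-identityʳ _))) , refl))

  -- Here δ = 1/q and r stands for 2^δ. The two results replace the law 2^(t+δ) = 2^t·r by
  -- inequalities that follow directly from the definition of 2^t as a supremum.
  module Step {r q δ} (0<r : 0# < r) (0<q : 0 ℕ.< q)
              (r^q≈2 : r ^ q ≈ 2#) (qδ≈1 : fromℕ q * δ ≈ 1#) where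

    private
      r^bq : ∀ b → r ^ (b ℕ.* q) ≈ 2# ^ b
      r^bq b = begin-equality
        r ^ (b ℕ.* q)  ≡⟨ ≡.cong (r ^_) (ℕₚ.*-comm b q) ⟩
        r ^ (q ℕ.* b)  ≈⟨ ^-assocʳ r q b ⟨
        (r ^ q) ^ b    ≈⟨ ^-congˡ b r^q≈2 ⟩
        2# ^ b         ∎

      y^bq : ∀ {y a b} → y ^ b ≈ 2# ^ a → y ^ (b ℕ.* q) ≈ 2# ^ (a ℕ.* q)
      y^bq {y} {a} {b} eq = begin-equality
        y ^ (b ℕ.* q)  ≈⟨ ^-assocʳ y b q ⟨
        (y ^ b) ^ q    ≈⟨ ^-congˡ q eq ⟩
        (2# ^ a) ^ q   ≈⟨ ^-assocʳ 2# a q ⟩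
        2# ^ (a ℕ.* q) ∎

      bq[t+δ] : ∀ b t → fromℕ (b ℕ.* q) * (t + δ) ≈ fromℕ b * t * fromℕ q + fromℕ b
      bq[t+δ] b t = begin-equality
        fromℕ (b ℕ.* q) * (t + δ)                         ≈⟨ *-congʳ (×1-homo-* b q) ⟩
        fromℕ b * fromℕ q * (t + δ)                       ≈⟨ solve 4 (λ b q t δ → b :* q :* (t :+ δ)
                                                               := b :* t :* q :+ b :* (q :* δ)) refl _ _ t δ ⟩
        fromℕ b * t * fromℕ q + fromℕ b * (fromℕ q * δ)   ≈⟨ +-congˡ (trans (*-congˡ qδ≈1) (*-identityʳ _)) ⟩
        fromℕ b * t * fromℕ q + fromℕ b                   ∎

      aq≤btq : ∀ {a b t} → fromℕ a ≤ fromℕ b * t → fromℕ (a ℕ.* q) ≤ fromℕ b * t * fromℕ q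
      aq≤btq {a} {b} {t} a≤bt = begin
        fromℕ (a ℕ.* q)        ≈⟨ ×1-homo-* a q ⟩
        fromℕ a * fromℕ q      ≤⟨ *-monoˡ-≤-nonneg (fromℕ-nonneg q) a≤bt ⟩
        fromℕ b * t * fromℕ q  ∎

      bq≥0 : ∀ b → 0# ≤ fromℕ (b ℕ.* q)
      bq≥0 b = fromℕ-nonneg (b ℕ.* q)

      0<bq : ∀ {b} → 0 ℕ.< b → 0 ℕ.< b ℕ.* q
      0<bq 0<b = ℕₚ.*-mono-≤ 0<b 0<q

    -- If y is the rational power with exponent a/b ≤ t, then y·r is the one with exponent (aq +
    -- b)/(bq) = a/b + δ ≤ t′, so it enters the supremum for t′.
    2^-step-up : ∀ t t′ → proj₁ t + δ ≤ proj₁ t′ → 2^ t * r ≤ 2^ t′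
    2^-step-up t t′ t+δ≤t′ = begin
      2^ t * r           ≤⟨ *-monoˡ-≤ r 0<r (2^-least t bound) ⟩
      2^ t′ * r ⁻¹ * r   ≈⟨ x*y⁻¹*y≈x _ 0<r ⟩
      2^ t′              ∎
      where
      bound : ∀ y → y ∈ RationalPower (proj₁ t) → y ≤ 2^ t′ * r ⁻¹
      bound y (0≤y , a , b , 0<b , a≤bt , eq) = *-cancelʳ-≤ 0<r (begin
        y * r             ≤⟨ 2^-upper t′ (*-nonneg 0≤y (inj₁ 0<r) , a ℕ.* q ℕ.+ b , b ℕ.* q , 0<bq 0<b , exponent , power) ⟩
        2^ t′             ≈⟨ x*y⁻¹*y≈x _ 0<r ⟨
        2^ t′ * r ⁻¹ * r  ∎)
        where
        exponent : fromℕ (a ℕ.* q ℕ.+ b) ≤ fromℕ (b ℕ.* q) * proj₁ t′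
        exponent = begin
          fromℕ (a ℕ.* q ℕ.+ b)                   ≈⟨ fromℕ-+ (a ℕ.* q) b ⟩
          fromℕ (a ℕ.* q) + fromℕ b               ≤⟨ +-monoˡ-≤ _ (aq≤btq {a} {b} a≤bt) ⟩
          fromℕ b * proj₁ t * fromℕ q + fromℕ b   ≈⟨ bq[t+δ] b (proj₁ t) ⟨
          fromℕ (b ℕ.* q) * (proj₁ t + δ)         ≤⟨ *-monoʳ-≤-nonneg (bq≥0 b) t+δ≤t′ ⟩
          fromℕ (b ℕ.* q) * proj₁ t′              ∎

        power : (y * r) ^ (b ℕ.* q) ≈ 2# ^ (a ℕ.* q ℕ.+ b)
        power = begin-equality
          (y * r) ^ (b ℕ.* q)              ≈⟨ ^-distrib-* y r (b ℕ.* q) ⟩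
          y ^ (b ℕ.* q) * r ^ (b ℕ.* q)    ≈⟨ *-cong (y^bq {y} {a} {b} eq) (r^bq b) ⟩
          2# ^ (a ℕ.* q) * 2# ^ b          ≈⟨ ^-homo-* 2# (a ℕ.* q) b ⟨
          2# ^ (a ℕ.* q ℕ.+ b)             ∎

    -- Dually, y/r has exponent a/b - δ ≤ t′. Only nonnegative exponents enter the supremum, so the
    -- case a/b < δ is separate: there y ≤ r, and 1 ≤ 2^t′ suffices.
    2^-step-down : ∀ t t′ → proj₁ t ≤ proj₁ t′ + δ → 2^ t ≤ 2^ t′ * r
    2^-step-down t t′ t≤t′+δ = 2^-least t bound
      where
      bound : ∀ y → y ∈ RationalPower (proj₁ t) → y ≤ 2^ t′ * r
      bound y (0≤y , a , b , 0<b , a≤bt , eq) with ℕₚ.<-≤-connex (a ℕ.* q) b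
      ... | inj₁ aq<b = begin
        y           ≤⟨ ^-cancel-≤ (0<bq 0<b) (inj₁ 0<r) (begin
                         y ^ (b ℕ.* q)   ≈⟨ y^bq {y} {a} {b} eq ⟩
                         2# ^ (a ℕ.* q)  ≤⟨ 2^-mono (ℕₚ.<⇒≤ aq<b) ⟩
                         2# ^ b          ≈⟨ r^bq b ⟨
                         r ^ (b ℕ.* q)   ∎) ⟩
        r           ≈⟨ *-identityˡ r ⟨
        1# * r      ≤⟨ *-monoˡ-≤ r 0<r (1≤2^ t′) ⟩
        2^ t′ * r   ∎
      ... | inj₂ b≤aq = begin
        y           ≈⟨ x*y⁻¹*y≈x y 0<r ⟨
        z * r       ≤⟨ *-monoˡ-≤ r 0<r (2^-upper t′
                         (*-nonneg 0≤y (inj₁ (⁻¹-pos 0<r)) , p , b ℕ.* q , 0<bq 0<b , exponent , power)) ⟩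
        2^ t′ * r   ∎
        where
        z = y * r ⁻¹
        p = a ℕ.* q ℕ.∸ b

        p+b≡aq : p ℕ.+ b ≡ a ℕ.* q
        p+b≡aq = ℕₚ.m∸n+n≡m b≤aq

        exponent : fromℕ p ≤ fromℕ (b ℕ.* q) * proj₁ t′
        exponent = +-cancelʳ-≤ (fromℕ b) (begin
          fromℕ p + fromℕ b                         ≈⟨ fromℕ-+ p b ⟨
          fromℕ (p ℕ.+ b)                           ≡⟨ ≡.cong fromℕ p+b≡aq ⟩
          fromℕ (a ℕ.* q)                           ≤⟨ aq≤btq {a} {b} a≤bt ⟩
          fromℕ b * proj₁ t * fromℕ q               ≈⟨ btq≈bqt (proj₁ t) ⟩
          fromℕ (b ℕ.* q) * proj₁ t                 ≤⟨ *-monoʳ-≤-nonneg (bq≥0 b) t≤t′+δ ⟩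
          fromℕ (b ℕ.* q) * (proj₁ t′ + δ)          ≈⟨ bq[t+δ] b (proj₁ t′) ⟩
          fromℕ b * proj₁ t′ * fromℕ q + fromℕ b    ≈⟨ +-congʳ (btq≈bqt (proj₁ t′)) ⟩
          fromℕ (b ℕ.* q) * proj₁ t′ + fromℕ b      ∎)
          where
          btq≈bqt : ∀ t → fromℕ b * t * fromℕ q ≈ fromℕ (b ℕ.* q) * t
          btq≈bqt t = trans (solve 3 (λ b q t → b :* t :* q := b :* q :* t) refl _ _ t)
                        (*-congʳ (sym (×1-homo-* b q)))

        power : z ^ (b ℕ.* q) ≈ 2# ^ p
        power = *-cancelʳ-≈ (^-pos b 0<2) (begin-equality
          z ^ (b ℕ.* q) * 2# ^ b             ≈⟨ *-congˡ (r^bq b) ⟨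
          z ^ (b ℕ.* q) * r ^ (b ℕ.* q)      ≈⟨ ^-distrib-* z r (b ℕ.* q) ⟨
          (z * r) ^ (b ℕ.* q)                ≈⟨ ^-congˡ (b ℕ.* q) (x*y⁻¹*y≈x y 0<r) ⟩
          y ^ (b ℕ.* q)                      ≈⟨ y^bq {y} {a} {b} eq ⟩
          2# ^ (a ℕ.* q)                     ≡⟨ ≡.cong (2# ^_) p+b≡aq ⟨
          2# ^ (p ℕ.+ b)                     ≈⟨ ^-homo-* 2# p b ⟩
          2# ^ p * 2# ^ b                    ∎)

-- A modulus of continuity and of growth for 2^t.

module Modulus (em : ∀ {ℓ} → ExcludedMiddle ℓ) (R : CompleteOrderedField) where

  open Construction em R hiding (zero)
  open OrderedFieldProperties R
  open PowersOfTwo R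
  open ≤-Reasoning

  n≤2^n : ∀ n → n ℕ.≤ 2 ℕ.^ n
  n≤2^n zero    = z≤n
  n≤2^n (suc n) = ℕₚ.+-mono-≤ (ℕₚ.m^n>0 2 n) (ℕₚ.≤-trans (n≤2^n n) (ℕₚ.m≤m+n _ 0))

  -- Take q = 2^k at least 1/ε, let 1 + d be the q-th root of 2 from `2^-root`, and put δ = 1/q.
  -- Both d and δ are then at most 1/q ≤ ε, and `Step` applies with r = 1 + d.
  2^-modulus : ∀ ε → 0# < ε → ∃[ d ] ∃[ δ ] 0# < d × d ≤ ε × 0# < δ × δ ≤ ε
    × (∀ t t′ → proj₁ t + δ ≤ proj₁ t′ → 2^ t * (1# + d) ≤ 2^ t′)
    × (∀ t t′ → proj₁ t ≤ proj₁ t′ + δ → 2^ t ≤ 2^ t′ * (1# + d))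
  2^-modulus ε 0<ε =
    let k , ε⁻¹<k           = archimedean (ε ⁻¹)
        d , 0<d , Qd≤1 , eq = 2^-root k
        q    = 2 ℕ.^ k
        0<q  = ℕₚ.m^n>0 2 k
        0<Q  = fromℕ-pos 0<q
        1≤εQ = begin
          1#            ≈⟨ *-inverseʳ ε (pos⇒≉0 0<ε) ⟨
          ε * ε ⁻¹      ≤⟨ *-monoʳ-≤ ε 0<ε (≤-trans (inj₁ ε⁻¹<k) (fromℕ-mono (n≤2^n k))) ⟩
          ε * fromℕ q   ∎
        Qδ≈1 = *-inverseʳ (fromℕ q) (pos⇒≉0 0<Q)
        0<r  = +-pos-nonneg 0<1 (inj₁ 0<d)
    in d , fromℕ q ⁻¹ , 0<d
     , *-cancelʳ-≤ 0<Q (≤-trans (inj₂ (*-comm d _)) (≤-trans Qd≤1 1≤εQ))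
     , ⁻¹-pos 0<Q
     , *-cancelʳ-≤ 0<Q (≤-trans (inj₂ (*-comm _ _)) (≤-trans (inj₂ Qδ≈1) 1≤εQ))
     , Step.2^-step-up 0<r 0<q eq Qδ≈1
     , Step.2^-step-down 0<r 0<q eq Qδ≈1

-- Translates of sets and the iterates of τ⁻¹.

module Ultrafilters where

  shift : ℕ → ℕ⁺ → ℕ⁺
  shift k n = [1+ k ℕ.+ pred n ]

  shift[_] : ℕ → 𝒫ℕ⁺ → 𝒫ℕ⁺
  shift[ k ] A n = ∃[ j ] j ∈ A × n ≡ shift k j

  upward* : ∀ ω {A B : 𝒫ℕ⁺} → (∀ n → n ∈ A → n ∈ B) → ω ∋ A → ω ∋ B
  upward* ω A⊆B = upward (proj₁ ω) λ {n} → A⊆B n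

  -- Since `τ⁻¹` is defined through images under the successor, iterating it k times tests the
  -- translate A + k against ω. The converse follows below.
  τ⁻ᵏ∋⇒∋shift : ∀ k ω {A} → fold ω τ⁻¹ k ∋ A → ω ∋ shift[ k ] A
  τ⁻ᵏ∋⇒∋shift zero    ω p = upward* ω (λ n n∈A → n , n∈A , ≡.refl) p
  τ⁻ᵏ∋⇒∋shift (suc k) ω p = upward* ω
    (λ { n (_ , (j , j∈A , ≡.refl) , ≡.refl) → j , j∈A , ≡.cong [1+_] (ℕₚ.+-suc k (pred j)) })
    (τ⁻ᵏ∋⇒∋shift k ω p)

  ∋shift⇒τ⁻ᵏ∋ : ∀ k ω {A} → ω ∋ shift[ k ] A → fold ω τ⁻¹ k ∋ A
  ∋shift⇒τ⁻ᵏ∋ zero    ω p = upward* ω (λ { n (_ , n∈A , ≡.refl) → n∈A }) p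
  ∋shift⇒τ⁻ᵏ∋ (suc k) ω p = ∋shift⇒τ⁻ᵏ∋ k ω (upward* ω
    (λ { n (j , j∈A , ≡.refl) → suc⁺ j , (j , j∈A , ≡.refl) , ≡.cong [1+_] (≡.sym (ℕₚ.+-suc k (pred j))) }) p)

  -- Freeness removes one point at a time; induction removes every initial segment.
  large-indices : ∀ ω N → ω ∋ λ n → N ℕ.< toℕ n
  large-indices ω zero    = upward* ω (λ _ _ → s≤s z≤n) (universe (proj₁ ω))
  large-indices ω (suc N) =
    let A , A∈ω , N∉A = proj₂ ω [1+ N ]
    in upward* ω
        (λ { [1+ n ] (s≤s N≤n , n∈A) → s≤s (ℕₚ.≤∧≢⇒< N≤n λ { ≡.refl → N∉A n∈A }) })
        (meet (proj₁ ω) (large-indices ω N) A∈ω)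

-- Growth of the counting function.

module Counting (em : ∀ {ℓ} → ExcludedMiddle ℓ) (R : CompleteOrderedField) where

  open Construction em R hiding (zero)
  open OrderedFieldProperties R
  open PowersOfTwo R

  -- `applyUpTo` unfolds at the front of the list, whereas every induction on `count` splits off the
  -- last element.
  count-suc : ∀ A m → count A (suc m) ≡ count A m ℕ.+ length (filter (λ n → em {P = n ∈ A}) ([1+ m ] ∷ []))
  count-suc A m = ≡.trans
    (≡.cong (length ∘ filter A?) (≡.sym (applyUpTo-∷ʳ [1+_] m)))
    (≡.trans (≡.cong length (filter-++ A? (applyUpTo [1+_] m) _)) (length-++ (filter A? (applyUpTo [1+_] m))))
    where
    A? = λ n → em {P = n ∈ A}

  count-∈ : ∀ A m → [1+ m ] ∈ A → count A (suc m) ≡ suc (count A m)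
  count-∈ A m m∈A = ≡.trans (count-suc A m) (≡.trans
    (≡.cong ((count A m ℕ.+_) ∘ length) (filter-accept (λ n → em {P = n ∈ A}) m∈A)) (ℕₚ.+-comm _ 1))

  count-∉ : ∀ A m → [1+ m ] ∉ A → count A (suc m) ≡ count A m
  count-∉ A m m∉A = ≡.trans (count-suc A m) (≡.trans
    (≡.cong ((count A m ℕ.+_) ∘ length) (filter-reject (λ n → em {P = n ∈ A}) m∉A)) (ℕₚ.+-identityʳ _))

  count≤ : ∀ A m → count A m ℕ.≤ m
  count≤ A m = ℕₚ.≤-trans (length-filter _ (applyUpTo [1+_] m)) (ℕₚ.≤-reflexive (length-applyUpTo [1+_] m))

  count-≤suc : ∀ A m → count A m ℕ.≤ count A (suc m)
  count-≤suc A m with em {P = [1+ m ] ∈ A}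
  ... | yes m∈A = ℕₚ.≤-trans (ℕₚ.n≤1+n _) (ℕₚ.≤-reflexive (≡.sym (count-∈ A m m∈A)))
  ... | no  m∉A = ℕₚ.≤-reflexive (≡.sym (count-∉ A m m∉A))

  count-suc≤ : ∀ A m → count A (suc m) ℕ.≤ suc (count A m)
  count-suc≤ A m with em {P = [1+ m ] ∈ A}
  ... | yes m∈A = ℕₚ.≤-reflexive (count-∈ A m m∈A)
  ... | no  m∉A = ℕₚ.≤-trans (ℕₚ.≤-reflexive (count-∉ A m m∉A)) (ℕₚ.n≤1+n _)

  count-mono : ∀ A {m n} → m ℕ.≤ n → count A m ℕ.≤ count A n
  count-mono A {m} m≤n with ℕₚ.m≤n⇒∃[o]m+o≡n m≤n
  ... | k , ≡.refl = go k
    where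
    go : ∀ k → count A m ℕ.≤ count A (m ℕ.+ k)
    go zero    = ℕₚ.≤-reflexive (≡.cong (count A) (≡.sym (ℕₚ.+-identityʳ m)))
    go (suc k) = ℕₚ.≤-trans (go k) (ℕₚ.≤-trans (count-≤suc A _)
      (ℕₚ.≤-reflexive (≡.cong (count A) (≡.sym (ℕₚ.+-suc m k)))))

  count-lipschitz : ∀ A m k → count A (m ℕ.+ k) ℕ.≤ count A m ℕ.+ k
  count-lipschitz A m zero    = ℕₚ.≤-reflexive (≡.trans (≡.cong (count A) (ℕₚ.+-identityʳ m)) (≡.sym (ℕₚ.+-identityʳ _)))
  count-lipschitz A m (suc k) = begin
    count A (m ℕ.+ suc k)      ≡⟨ ≡.cong (count A) (ℕₚ.+-suc m k) ⟩
    count A (suc (m ℕ.+ k))    ≤⟨ count-suc≤ A (m ℕ.+ k) ⟩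
    suc (count A (m ℕ.+ k))    ≤⟨ s≤s (count-lipschitz A m k) ⟩
    suc (count A m ℕ.+ k)      ≡⟨ ℕₚ.+-suc (count A m) k ⟨
    count A m ℕ.+ suc k        ∎
    where open ℕₚ.≤-Reasoning

  -- `count A` is monotone and rises by at most 1 per step. The real error e and the free order of m
  -- and n suit integer parts of two nearby scales.
  count-increment : ∀ A m n {e} → 0# ≤ e → fromℕ n ≤ fromℕ m + e →
    fromℕ (count A n) ≤ fromℕ (count A m) + e
  count-increment A m n {e} 0≤e n≤m+e with ℕₚ.≤-total n m
  ... | inj₁ n≤m = ≤-trans (fromℕ-mono (count-mono A n≤m)) (x≤x+nonneg _ 0≤e)
  ... | inj₂ m≤n with ℕₚ.m≤n⇒∃[o]m+o≡n m≤n
  ...   | k , ≡.refl = begin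
    fromℕ (count A (m ℕ.+ k))      ≤⟨ fromℕ-mono (count-lipschitz A m k) ⟩
    fromℕ (count A m ℕ.+ k)        ≈⟨ fromℕ-+ (count A m) k ⟩
    fromℕ (count A m) + fromℕ k    ≤⟨ +-monoʳ-≤ _ k≤e ⟩
    fromℕ (count A m) + e          ∎
    where
    open ≤-Reasoning
    k≤e : fromℕ k ≤ e
    k≤e = +-cancelʳ-≤ (fromℕ m) (begin
      fromℕ k + fromℕ m   ≈⟨ trans (fromℕ-+ m k) (+-comm _ _) ⟨
      fromℕ (m ℕ.+ k)     ≤⟨ n≤m+e ⟩
      fromℕ m + e         ≈⟨ +-comm _ _ ⟩
      e + fromℕ m         ∎)

  -- Among 1, ..., n only the first m numbers can be missing from A; the additive form avoids
  -- truncated subtraction.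
  count-interval : ∀ A m n → (∀ j → m ℕ.≤ j → j ℕ.< n → [1+ j ] ∈ A) → n ℕ.≤ count A n ℕ.+ m
  count-interval A m zero    _       = z≤n
  count-interval A m (suc n) [m,n]⊆A with ℕₚ.≤-<-connex m n
  ... | inj₂ n<m = ℕₚ.≤-trans n<m (ℕₚ.m≤n+m m _)
  ... | inj₁ m≤n = ℕₚ.≤-trans
    (s≤s (count-interval A m n λ j m≤j j<n → [m,n]⊆A j m≤j (ℕₚ.m<n⇒m<1+n j<n)))
    (ℕₚ.≤-reflexive (≡.cong (ℕ._+ m) (≡.sym (count-∈ A n ([m,n]⊆A n m≤n ℕₚ.≤-refl)))))

  -- The count never exceeds the largest element counted, which lies below c; 0 < c covers the empty
  -- case.
  count-bound : ∀ A n {c} → 0# < c → (∀ j → j ℕ.< n → [1+ j ] ∈ A → fromℕ (suc j) < c) →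
    fromℕ (count A n) < c
  count-bound A zero    0<c _ = 0<c
  count-bound A (suc n) {c} 0<c A<c with em {P = [1+ n ] ∈ A}
  ... | yes n∈A = ≤-<-trans (fromℕ-mono (count≤ A (suc n))) (A<c n ℕₚ.≤-refl n∈A)
  ... | no  n∉A = ≡.subst (λ k → fromℕ k < c) (≡.sym (count-∉ A n n∉A))
    (count-bound A n 0<c λ j j<n → A<c j (ℕₚ.m<n⇒m<1+n j<n))

-- Null sets of ν_η in terms of counts.

module NullSets (em : ∀ {ℓ} → ExcludedMiddle ℓ) (R : CompleteOrderedField) where

  open Construction em R hiding (zero)
  open OrderedFieldProperties R
  open PowersOfTwo R
  open Counting em R
  open Ultrafilters
  open ≤-Reasoning

  ∣⌊⌋∣-greatest : ∀ {x k} → fromℕ k ≤ x → k ℕ.≤ ℤ.∣ ⌊ x ⌋ ∣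
  ∣⌊⌋∣-greatest {x} {k} k≤x = drop (proj₂ (proj₂ (floor x)) (+ k) k≤x)
    where
    drop : ∀ {k j} → + k ℤ.≤ j → k ℕ.≤ ℤ.∣ j ∣
    drop (ℤ.+≤+ k≤j) = k≤j

  x<1+∣⌊x⌋∣ : ∀ x → x < 1# + fromℕ ℤ.∣ ⌊ x ⌋ ∣
  x<1+∣⌊x⌋∣ x = ≰⇒> λ p → ℕₚ.1+n≰n (∣⌊⌋∣-greatest {x} {suc ℤ.∣ ⌊ x ⌋ ∣} p)

  ∣⌊⌋∣-mono : ∀ {x y} → 0# ≤ x → x ≤ y → ℤ.∣ ⌊ x ⌋ ∣ ℕ.≤ ℤ.∣ ⌊ y ⌋ ∣
  ∣⌊⌋∣-mono 0≤x x≤y = ∣⌊⌋∣-greatest (≤-trans (∣⌊⌋∣≤ 0≤x) x≤y)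

  scale : I → ℕ⁺ → Carrier
  scale t n = 2^ t * 2# ^ toℕ n

  2^n≤scale : ∀ t n → 2# ^ toℕ n ≤ scale t n
  2^n≤scale t n = ≤-trans (inj₂ (sym (*-identityˡ _))) (*-monoˡ-≤ _ (^-pos (toℕ n) 0<2) (1≤2^ t))

  scale≤2*2^n : ∀ t n → scale t n ≤ 2# * 2# ^ toℕ n
  scale≤2*2^n t n = *-monoˡ-≤ _ (^-pos (toℕ n) 0<2) (2^≤2 t)

  scale-pos : ∀ t n → 0# < scale t n
  scale-pos t n = <-≤-trans (^-pos (toℕ n) 0<2) (2^n≤scale t n)

  scale-mono : ∀ t t′ n → proj₁ t ≤ proj₁ t′ → scale t n ≤ scale t′ n
  scale-mono t t′ n t≤t′ = *-monoˡ-≤ _ (^-pos (toℕ n) 0<2) (2^-monotone t t′ t≤t′)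

  scale-shift : ∀ t k n → scale t (shift k n) ≈ 2# ^ k * scale t n
  scale-shift t k n = begin-equality
    2^ t * 2# ^ toℕ (shift k n)    ≡⟨ ≡.cong (λ i → 2^ t * 2# ^ i) (≡.sym (ℕₚ.+-suc k (pred n))) ⟩
    2^ t * 2# ^ (k ℕ.+ toℕ n)      ≈⟨ *-congˡ (^-homo-* 2# k (toℕ n)) ⟩
    2^ t * (2# ^ k * 2# ^ toℕ n)   ≈⟨ solve 3 (λ a b c → a :* (b :* c) := b :* (a :* c)) refl _ _ _ ⟩
    2# ^ k * scale t n             ∎

  fromℕ≤2^ : ∀ n → fromℕ n ≤ 2# ^ n
  fromℕ≤2^ zero    = 0≤1
  fromℕ≤2^ (suc n) = begin
    1# + fromℕ n      ≤⟨ +-mono-≤ (2^-mono (z≤n {n})) (fromℕ≤2^ n) ⟩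
    2# ^ n + 2# ^ n   ≈⟨ solve 1 (λ x → x :+ x := con (+ 2) :* x) refl _ ⟩
    2# * 2# ^ n       ∎

  2^-unbounded : ∀ c → ∃[ N ] c < 2# ^ N
  2^-unbounded c = let N , c<N = archimedean c in N , <-≤-trans c<N (fromℕ≤2^ N)

  eventually-2^> : ∀ ω c → ω ∋ λ n → c < 2# ^ toℕ n
  eventually-2^> ω c = let N , c<2^N = 2^-unbounded c in
    upward* ω (λ n N<n → <-≤-trans c<2^N (2^-mono (ℕₚ.<⇒≤ N<n))) (large-indices ω N)

  -- Density below ε on [1, x], multiplied out to avoid the inverse of x.
  Thin : 𝒫ℕ⁺ → Carrier → Carrier → Set
  Thin A ε x = fromℕ (count A ℤ.∣ ⌊ x ⌋ ∣) < ε * x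

  -- Densities are nonnegative, so an upper estimate for each ε already expresses that their
  -- ultralimit is 0; see `ν≈0⇒Null` and `Null⇒ν≈0`.
  Null : Ω* → 𝒫ℕ⁺ → Set
  Null (ω , t) A = ∀ ε → 0# < ε → ω ∋ λ n → Thin A ε (scale t n)

  Thin-resp-≈ : ∀ {A ε x y} → 0# < x → x ≈ y → Thin A ε x → Thin A ε y
  Thin-resp-≈ {A} {ε} {x} {y} 0<x x≈y thin = begin-strict
    fromℕ (count A ℤ.∣ ⌊ y ⌋ ∣)   ≤⟨ fromℕ-mono (count-mono A (∣⌊⌋∣-mono (inj₁ (O.<-respʳ-≈ x≈y 0<x)) (inj₂ (sym x≈y)))) ⟩
    fromℕ (count A ℤ.∣ ⌊ x ⌋ ∣)   <⟨ thin ⟩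
    ε * x                         ≈⟨ *-congˡ x≈y ⟩
    ε * y                         ∎

  -- Passing to a smaller interval does not raise the count, and the length falls at most by the
  -- factor C, which the smaller tolerance ε/C absorbs.
  Thin-shrink : ∀ {A ε C x y} → 0# < ε → 0# < C → 0# < y → y ≤ x → x ≤ C * y →
    Thin A (ε * C ⁻¹) x → Thin A ε y
  Thin-shrink {A} {ε} {C} {x} {y} 0<ε 0<C 0<y y≤x x≤Cy thin = begin-strict
    fromℕ (count A ℤ.∣ ⌊ y ⌋ ∣)   ≤⟨ fromℕ-mono (count-mono A (∣⌊⌋∣-mono (inj₁ 0<y) y≤x)) ⟩
    fromℕ (count A ℤ.∣ ⌊ x ⌋ ∣)   <⟨ thin ⟩
    ε * C ⁻¹ * x                  ≤⟨ *-monoʳ-≤ _ (*-pos 0<ε (⁻¹-pos 0<C)) x≤Cy ⟩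
    ε * C ⁻¹ * (C * y)            ≈⟨ *-assoc _ C y ⟨
    ε * C ⁻¹ * C * y              ≈⟨ *-congʳ (x*y⁻¹*y≈x ε 0<C) ⟩
    ε * y                         ∎

  density*scale : ∀ t A n → density t A n * scale t n ≈ fromℕ (count A ℤ.∣ ⌊ scale t n ⌋ ∣)
  density*scale t A n = x*y⁻¹*y≈x _ (scale-pos t n)

  ν-isUltralimit : ∀ ω t A → ν (ω , t) A ∈ IsUltralimit ω (density t A)
  ν-isUltralimit ω t A = proj₂ (ultralimit ω (density t A) (density-bounds t A))

  ν≈0⇒Null : ∀ η A → ν η A ≈ 0# → Null η A
  ν≈0⇒Null (ω , t) A ν≈0 ε 0<ε = upward* ω
    (λ n (f<L+ε , _) → begin-strict
      fromℕ (count A ℤ.∣ ⌊ scale t n ⌋ ∣)     ≈⟨ density*scale t A n ⟨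
      density t A n * scale t n               <⟨ *-monoˡ-< _ (scale-pos t n) f<L+ε ⟩
      (ν (ω , t) A + ε) * scale t n           ≈⟨ *-congʳ (trans (+-congʳ ν≈0) (+-identityˡ ε)) ⟩
      ε * scale t n                           ∎)
    (ν-isUltralimit ω t A ε 0<ε)

  Null⇒ν≈0 : ∀ η A → Null η A → ν η A ≈ 0#
  Null⇒ν≈0 (ω , t) A null with O.compare (ν (ω , t) A) 0#
  ... | tri≈ _ ν≈0 _ = ν≈0
  -- With tolerance -L, where L is the limit, almost all densities would be below L - L = 0.
  ... | tri< ν<0 _ _ = ⊥-elim (proper (proj₁ ω) (upward* ω
    (λ n (f<L-L , _) → ≤⇒≯ (proj₁ (density-bounds t A n)) (O.<-respʳ-≈ (-‿inverseʳ _) f<L-L))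
    (ν-isUltralimit ω t A (- ν (ω , t) A) (O.<-respˡ-≈ RP.-0#≈0# (-‿anti-< ν<0)))))
  -- With ε = L/2, thinness puts the density below ε, while closeness to L puts it above L - ε = ε.
  ... | tri> _ _ 0<L = ⊥-elim (proper (proj₁ ω) (upward* ω
    (λ n ((_ , L<f+ε) , thin) → O.irrefl refl (begin-strict
      L                        <⟨ L<f+ε ⟩
      density t A n + ε        <⟨ +-monoˡ-< ε (*-cancelʳ-< (scale-pos t n)
                                    (O.<-respˡ-≈ (sym (density*scale t A n)) thin)) ⟩
      ε + ε                    ≈⟨ solve 1 (λ e → e :+ e := e :* con (+ 2)) refl ε ⟩
      ε * 2#                   ≈⟨ x*y⁻¹*y≈x L 0<2 ⟩
      L                        ∎))
    (meet (proj₁ ω) (ν-isUltralimit ω t A ε 0<ε) (null ε 0<ε))))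
    where
    L = ν (ω , t) A
    ε = L * 2# ⁻¹
    0<ε = *-pos 0<L (⁻¹-pos 0<2)

-- Null sets under gluing, along backward orbits and under small perturbations.

module NullOrbits (em : ∀ {ℓ} → ExcludedMiddle ℓ) (R : CompleteOrderedField) where

  open Construction em R hiding (zero)
  open OrderedFieldProperties R
  open PowersOfTwo R
  open Modulus em R
  open Counting em R
  open NullSets em R
  open Ultrafilters
  open ≤-Reasoning

  Null-resp-equal : ∀ {A ω ω′} t t′ → ω ≈ᵤ ω′ → proj₁ t ≈ proj₁ t′ → Null (ω , t) A → Null (ω′ , t′) A
  Null-resp-equal {A} {ω} {ω′} t t′ (ω⊆ω′ , _) t≈t′ null ε 0<ε = ω⊆ω′
    (upward* ω (λ n → Thin-resp-≈ {A} (scale-pos t n) (*-congʳ (2^-cong t t′ t≈t′))) (null ε 0<ε))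

  -- This is 2^1·2^n = 2^0·2^(n+1): glued points have the same scales with indices shifted by one,
  -- so nullity is well defined on the quotient.
  scale-glue : ∀ t t′ → proj₁ t ≈ 1# → proj₁ t′ ≈ 0# → ∀ n → scale t n ≈ scale t′ (suc⁺ n)
  scale-glue t t′ t≈1 t′≈0 n = begin-equality
    2^ t * 2# ^ toℕ n            ≈⟨ *-congʳ (2^1≈2 t t≈1) ⟩
    2# * 2# ^ toℕ n              ≈⟨ *-identityˡ _ ⟨
    1# * (2# * 2# ^ toℕ n)       ≈⟨ *-congʳ (2^0≈1 t′ t′≈0) ⟨
    2^ t′ * (2# * 2# ^ toℕ n)    ∎

  Null-glue⇒ : ∀ {A ω ω′} t t′ → proj₁ t ≈ 1# → ω′ ≈ᵤ τ ω → proj₁ t′ ≈ 0# → Null (ω , t) A → Null (ω′ , t′) A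
  Null-glue⇒ {A} {ω} t t′ t≈1 (_ , τω⊆ω′) t′≈0 null ε 0<ε = τω⊆ω′
    (upward* ω (λ n → Thin-resp-≈ {A} (scale-pos t n) (scale-glue t t′ t≈1 t′≈0 n)) (null ε 0<ε))

  Null-glue⇐ : ∀ {A ω ω′} t t′ → proj₁ t ≈ 1# → ω′ ≈ᵤ τ ω → proj₁ t′ ≈ 0# → Null (ω′ , t′) A → Null (ω , t) A
  Null-glue⇐ {A} {ω} t t′ t≈1 (ω′⊆τω , _) t′≈0 null ε 0<ε =
    upward* ω (λ n → Thin-resp-≈ {A} (scale-pos t′ (suc⁺ n)) (sym (scale-glue t t′ t≈1 t′≈0 n)))
      (ω′⊆τω (null ε 0<ε))

  Null-resp-∼ : ∀ {A η ζ} → η ∼ ζ → Null η A → Null ζ A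
  Null-resp-∼ [] null = null
  Null-resp-∼ {A} (fwd (equal {ω} {ω′} {t} {t′} ω≈ t≈) ◅ rest) null =
    Null-resp-∼ {A} rest (Null-resp-equal {A} {ω} {ω′} t t′ ω≈ t≈ null)
  Null-resp-∼ {A} (bwd (equal {ω} {ω′} {t} {t′} (l , r) t≈) ◅ rest) null =
    Null-resp-∼ {A} rest (Null-resp-equal {A} {ω′} {ω} t′ t (r , l) (sym t≈) null)
  Null-resp-∼ {A} (fwd (glue {ω} {ω′} {t} {t′} t≈1 ω≈ t′≈0) ◅ rest) null =
    Null-resp-∼ {A} rest (Null-glue⇒ {A} {ω} {ω′} t t′ t≈1 ω≈ t′≈0 null)
  Null-resp-∼ {A} (bwd (glue {ω} {ω′} {t} {t′} t≈1 ω≈ t′≈0) ◅ rest) null =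
    Null-resp-∼ {A} rest (Null-glue⇐ {A} {ω} {ω′} t t′ t≈1 ω≈ t′≈0 null)

  -- The hypothesis places k + t′ behind t on the flow line. For k ≤ 0 the scales shrink by a
  -- bounded factor and `Thin-shrink` applies; k = 1 forces t = 1 and t′ = 0, a gluing; k ≥ 2
  -- contradicts t ≤ 1.
  Null-backward : ∀ {A ω} k t t′ → fromℤ k + proj₁ t′ ≤ proj₁ t → Null (ω , t) A → Null (τ^ k ω , t′) A
  Null-backward {A} {ω} (+ zero) t t′ t′≤t null ε 0<ε = upward* ω
    (λ n → Thin-shrink {A} 0<ε 0<2 (scale-pos t′ n)
      (scale-mono t′ t n (≤-trans (inj₂ (sym (+-identityˡ _))) t′≤t))
      (≤-trans (scale≤2*2^n t n) (*-monoʳ-≤ 2# 0<2 (2^n≤scale t′ n))))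
    (null (ε * 2# ⁻¹) (*-pos 0<ε (⁻¹-pos 0<2)))
  Null-backward {A} {ω} (+ suc zero) t@(_ , _ , t≤1) t′@(_ , 0≤t′ , _) 1+t′≤t null =
    Null-glue⇒ {A} {ω} {τ ω} t t′ (≤-antisym t≤1 1≤t) (id , id) (≤-antisym t′≤0 0≤t′) null
    where
    1≤t : 1# ≤ proj₁ t
    1≤t = ≤-trans (≤-trans (inj₂ (sym (+-identityʳ 1#))) (x≤x+nonneg _ 0≤t′)) 1+t′≤t

    t′≤0 : proj₁ t′ ≤ 0#
    t′≤0 = +-cancelʳ-≤ 1# (begin
      proj₁ t′ + 1#          ≈⟨ solve 1 (λ x → x :+ con (+ 1) := con (+ 1) :+ con (+ 0) :+ x) refl _ ⟩
      1# + 0# + proj₁ t′     ≤⟨ 1+t′≤t ⟩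
      proj₁ t                ≤⟨ t≤1 ⟩
      1#                     ≈⟨ +-identityˡ 1# ⟨
      0# + 1#                ∎)
  Null-backward (+ suc (suc m)) (_ , _ , t≤1) (_ , 0≤t′ , _) 2+m+t′≤t _
    with fromℕ-cancel {suc (suc m)} {1} (≤-trans (x≤x+nonneg _ 0≤t′)
           (≤-trans 2+m+t′≤t (≤-trans t≤1 (inj₂ (sym (+-identityʳ 1#))))))
  ... | s≤s ()
  Null-backward {A} {ω} -[1+ m ] t t′ _ null ε 0<ε = ∋shift⇒τ⁻ᵏ∋ k ω (upward* ω
    (λ { n (thin , (j , _ , ≡.refl)) → j
      , Thin-shrink {A} 0<ε 0<C (scale-pos t′ j) (lower j) (upper j) thin
      , ≡.refl })
    (meet (proj₁ ω) (null (ε * C ⁻¹) (*-pos 0<ε (⁻¹-pos 0<C)))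
      (τ⁻ᵏ∋⇒∋shift k ω (universe (proj₁ (fold ω τ⁻¹ k))))))
    where
    k = suc m
    -- The factor 2^k comes from the index shift, the other 2 from comparing 2^t with 2^t′, both in
    -- [1,2].
    C = 2# ^ k * 2#

    0<C : 0# < C
    0<C = *-pos (^-pos k 0<2) 0<2

    lower : ∀ j → scale t′ j ≤ scale t (shift k j)
    lower j = begin
      scale t′ j              ≤⟨ scale≤2*2^n t′ j ⟩
      2# * 2# ^ toℕ j         ≈⟨ *-congʳ (*-identityʳ 2#) ⟨
      2# ^ 1 * 2# ^ toℕ j     ≤⟨ *-monoˡ-≤ _ (^-pos (toℕ j) 0<2) (2^-mono {1} {k} (s≤s z≤n)) ⟩
      2# ^ k * 2# ^ toℕ j     ≤⟨ *-monoʳ-≤ _ (^-pos k 0<2) (2^n≤scale t j) ⟩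
      2# ^ k * scale t j      ≈⟨ scale-shift t k j ⟨
      scale t (shift k j)     ∎

    upper : ∀ j → scale t (shift k j) ≤ C * scale t′ j
    upper j = begin
      scale t (shift k j)               ≈⟨ scale-shift t k j ⟩
      2# ^ k * scale t j                ≤⟨ *-monoʳ-≤ _ (^-pos k 0<2) (scale≤2*2^n t j) ⟩
      2# ^ k * (2# * 2# ^ toℕ j)        ≈⟨ *-assoc _ _ _ ⟨
      C * 2# ^ toℕ j                    ≤⟨ *-monoʳ-≤ _ 0<C (2^n≤scale t′ j) ⟩
      C * scale t′ j                    ∎

  Null-φ : ∀ {A} η s → 0# ≤ s → Null η A → Null (φ (- s) η) A
  Null-φ {A} (ω , t) s 0≤s = Null-backward {A} {ω} ⌊ u ⌋ t (frac u) (begin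
    fromℤ ⌊ u ⌋ + (u - fromℤ ⌊ u ⌋)   ≈⟨ solve 2 (λ k u → k :+ (u :- k) := u) refl _ u ⟩
    proj₁ t - s                       ≤⟨ x≤x+nonneg _ 0≤s ⟩
    proj₁ t - s + s                   ≈⟨ x-z+z≈x _ s ⟩
    proj₁ t                           ∎)
    where
    u = proj₁ t + - s

  Null-o₋ : ∀ {A η ζ} → ζ ∈ o₋ η → Null η A → Null ζ A
  Null-o₋ {A} {η} (s , 0≤s , ζ∼φη) null =
    Null-resp-∼ {A} (EqClosure.symmetric Glue ζ∼φη) (Null-φ {A} η s 0≤s null)

  -- An ultrafilter turns "not for almost every n" into "for almost every n not".
  ¬Null⇒¬Thin : ∀ {A ω t} → ¬ Null (ω , t) A → ∃[ ε ] 0# < ε × ω ∋ λ n → ¬ Thin A ε (scale t n)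
  ¬Null⇒¬Thin {A} {ω} {t} ¬null with em {P = ∃[ ε ] 0# < ε × ω ∋ λ n → ¬ Thin A ε (scale t n)}
  ... | yes p = p
  ... | no ¬p = ⊥-elim (¬null thin)
    where
    thin : Null (ω , t) A
    thin ε 0<ε with total (proj₁ ω) (λ n → Thin A ε (scale t n))
    ... | inj₁ q = q
    ... | inj₂ q = ⊥-elim (¬p (ε , 0<ε , q))

  -- The set of n at which A is not ε-thin at scale t serves as the basic open set. If t′ is close
  -- to t, thinness at scale t′ with a small tolerance e would carry over to ε-thinness at scale t
  -- for large n, so no point nearby is null.
  ¬Null-open : ∀ A → Open (λ η → ¬ Null η A)
  ¬Null-open A = record
    { saturated = λ {η} {ζ} η∼ζ ¬null null → ¬null (Null-resp-∼ {A} {ζ} {η} (EqClosure.symmetric Glue η∼ζ) null)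
    ; open-nbhd = λ {ω} {t} → nbhd {ω} {t}
    }
    where
    nbhd : ∀ {ω t} → ¬ Null (ω , t) A → ∃[ B ] ∃[ δ ] ω ∋ B × 0# < δ ×
      (∀ ω′ t′ → ω′ ∋ B → ∣ proj₁ t′ - proj₁ t ∣< δ → ¬ Null (ω′ , t′) A)
    nbhd {ω} {t} ¬null =
      let ε , 0<ε , fat = ¬Null⇒¬Thin {A} {ω} {t} ¬null
          -- With x and x′ the scales at t and t′, three errors add up to 5ex = εx: thinness at x′ ≤
          -- 2x costs 2ex, rounding costs 1 ≤ ex, and the gap d·x′ between the scales costs 2ex.
          five = 2# + 2# + 1#
          0<5 = O.trans 0<1 (O.<-respʳ-≈ (+-comm 1# _) (x<x+pos 1# (+-pos-nonneg 0<2 (inj₁ 0<2))))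
          e = ε * five ⁻¹
          0<e = *-pos 0<ε (⁻¹-pos 0<5)
          d , δ , 0<d , d≤e , 0<δ , _ , _ , step-down = 2^-modulus e 0<e
      in (λ n → ¬ Thin A ε (scale t n)) , δ , fat , 0<δ , λ ω′ t′ fat′ (_ , t<t′+δ) null →
        proper (proj₁ ω′) (upward* ω′
          (λ n ((fatₙ , thinₙ) , e⁻¹<2^n) → fatₙ (let
              x  = scale t n
              x′ = scale t′ n
              m  = ℤ.∣ ⌊ x ⌋ ∣
              m′ = ℤ.∣ ⌊ x′ ⌋ ∣
              0<2^n = ^-pos (toℕ n) 0<2
              dx′≥0 = *-nonneg (inj₁ 0<d) (inj₁ (scale-pos t′ n))
              x′≤2x = ≤-trans (scale≤2*2^n t′ n) (*-monoʳ-≤ 2# 0<2 (2^n≤scale t n))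
              1≤ex = begin
                1#              ≈⟨ *-inverseʳ e (pos⇒≉0 0<e) ⟨
                e * e ⁻¹        ≤⟨ *-monoʳ-≤ e 0<e (inj₁ e⁻¹<2^n) ⟩
                e * 2# ^ toℕ n  ≤⟨ *-monoʳ-≤ e 0<e (2^n≤scale t n) ⟩
                e * x           ∎
            in begin-strict
              fromℕ (count A m)
                ≤⟨ count-increment A m′ m (+-nonneg 0≤1 dx′≥0) (begin
                     fromℕ m                        ≤⟨ ∣⌊⌋∣≤ (inj₁ (scale-pos t n)) ⟩
                     x                              ≤⟨ *-monoˡ-≤ _ 0<2^n (step-down t t′ (inj₁ t<t′+δ)) ⟩
                     2^ t′ * (1# + d) * 2# ^ toℕ n  ≈⟨ solve 3 (λ θ d p → θ :* (con (+ 1) :+ d) :* p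
                                                         := θ :* p :+ d :* (θ :* p)) refl _ d _ ⟩
                     x′ + d * x′                    ≤⟨ +-monoˡ-≤ _ (inj₁ (x<1+∣⌊x⌋∣ x′)) ⟩
                     1# + fromℕ m′ + d * x′         ≈⟨ solve 2 (λ m y → con (+ 1) :+ m :+ y
                                                         := m :+ (con (+ 1) :+ y)) refl _ _ ⟩
                     fromℕ m′ + (1# + d * x′)       ∎) ⟩
              fromℕ (count A m′) + (1# + d * x′)
                <⟨ +-monoˡ-< _ thinₙ ⟩
              e * x′ + (1# + d * x′)
                ≤⟨ +-mono-≤ (*-monoʳ-≤ e 0<e x′≤2x) (+-mono-≤ 1≤ex
                     (≤-trans (*-monoˡ-≤ x′ (scale-pos t′ n) d≤e) (*-monoʳ-≤ e 0<e x′≤2x))) ⟩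
              e * (2# * x) + (e * x + e * (2# * x))
                ≈⟨ solve 2 (λ e x → e :* (con (+ 2) :* x) :+ (e :* x :+ e :* (con (+ 2) :* x))
                     := e :* (con (+ 2) :+ con (+ 2) :+ con (+ 1)) :* x) refl e x ⟩
              e * five * x
                ≈⟨ *-congʳ (x*y⁻¹*y≈x ε 0<5) ⟩
              ε * x ∎))
          (meet (proj₁ ω′) (meet (proj₁ ω′) fat′ (null e 0<e)) (eventually-2^> ω′ (e ⁻¹))))

-- Points of the backward orbit, and the block set separating an open set from it.

module SeparatingSets (em : ∀ {ℓ} → ExcludedMiddle ℓ) (R : CompleteOrderedField) where

  open Construction em R hiding (zero)
  open OrderedFieldProperties R
  open PowersOfTwo R
  open Modulus em R
  open Counting em R
  open NullSets em R
  open Ultrafilters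
  open ≤-Reasoning

  floor-unique : ∀ {u} k → fromℤ k ≤ u → u < 1# + fromℤ k → ⌊ u ⌋ ≡ k
  floor-unique {u} k k≤u u<1+k = ℤₚ.≤-antisym
    (ℤₚ.≮⇒≥ λ k<⌊u⌋ → ≤⇒≯ (≤-trans (inj₂ (sym (fromℤ-suc k)))
      (≤-trans (fromℤ-mono (ℤₚ.i<j⇒suc[i]≤j k<⌊u⌋)) (proj₁ (proj₂ (floor u))))) u<1+k)
    (proj₂ (proj₂ (floor u)) k k≤u)

  τ^-suc : ∀ k ω → τ^ (ℤ.suc k) ω ≈ᵤ τ (τ^ k ω)
  τ^-suc (+ n)         ω = id , id
  τ^-suc -[1+ zero ]   ω = proj₂ (ττ⁻¹ ω) , proj₁ (ττ⁻¹ ω)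
  τ^-suc -[1+ suc n ]  ω = let ω⁻ = fold ω τ⁻¹ (suc n) in proj₂ (ττ⁻¹ ω⁻) , proj₁ (ττ⁻¹ ω⁻)

  -- The flow always yields representatives with second coordinate below 1. For t < 1 the two sides
  -- agree; for t = 1 the floor is k + 1 and the gluing relates them.
  normal-form : ∀ k ω t {u} → u ≈ proj₁ t + fromℤ k → (τ^ k ω , t) ∼ (τ^ ⌊ u ⌋ ω , frac u)
  normal-form k ω t@(t₀ , 0≤t , inj₁ t<1) {u} u≈t+k = EqClosure.return
    (equal (≡.subst (λ j → τ^ k ω ≈ᵤ τ^ j ω) (≡.sym ⌊u⌋≡k) (id , id)) t≈frac)
    where
    ⌊u⌋≡k : ⌊ u ⌋ ≡ k
    ⌊u⌋≡k = floor-unique k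
      (begin
        fromℤ k        ≤⟨ x≤x+nonneg _ 0≤t ⟩
        fromℤ k + t₀   ≈⟨ +-comm _ _ ⟩
        t₀ + fromℤ k   ≈⟨ u≈t+k ⟨
        u              ∎)
      (begin-strict
        u              ≈⟨ u≈t+k ⟩
        t₀ + fromℤ k   <⟨ +-monoˡ-< _ t<1 ⟩
        1# + fromℤ k   ∎)

    t≈frac : t₀ ≈ u - fromℤ ⌊ u ⌋
    t≈frac = begin-equality
      t₀                      ≈⟨ x+z-z≈x t₀ (fromℤ k) ⟨
      t₀ + fromℤ k - fromℤ k  ≈⟨ +-congʳ u≈t+k ⟨
      u - fromℤ k             ≡⟨ ≡.cong (λ j → u - fromℤ j) ⌊u⌋≡k ⟨
      u - fromℤ ⌊ u ⌋         ∎
  normal-form k ω t@(t₀ , _ , inj₂ t≈1) {u} u≈t+k = EqClosure.return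
    (glue t≈1 (≡.subst (λ j → τ^ j ω ≈ᵤ τ (τ^ k ω)) (≡.sym ⌊u⌋≡1+k) (τ^-suc k ω)) frac≈0)
    where
    u≈1+k : u ≈ fromℤ (ℤ.suc k)
    u≈1+k = begin-equality
      u                   ≈⟨ u≈t+k ⟩
      t₀ + fromℤ k        ≈⟨ +-congʳ t≈1 ⟩
      1# + fromℤ k        ≈⟨ fromℤ-suc k ⟨
      fromℤ (ℤ.suc k)     ∎

    ⌊u⌋≡1+k : ⌊ u ⌋ ≡ ℤ.suc k
    ⌊u⌋≡1+k = floor-unique (ℤ.suc k) (inj₂ (sym u≈1+k))
      (O.<-respˡ-≈ (sym u≈1+k) (O.<-respʳ-≈ (+-comm _ 1#) (x<x+pos _ 0<1)))

    frac≈0 : u - fromℤ ⌊ u ⌋ ≈ 0#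
    frac≈0 = begin-equality
      u - fromℤ ⌊ u ⌋         ≡⟨ ≡.cong (λ j → u - fromℤ j) ⌊u⌋≡1+k ⟩
      u - fromℤ (ℤ.suc k)     ≈⟨ +-congʳ u≈1+k ⟩
      fromℤ (ℤ.suc k) - fromℤ (ℤ.suc k) ≈⟨ -‿inverseʳ _ ⟩
      0#                      ∎

  τ⁻ᵏ∈o₋ : ∀ k ω t t′ → proj₁ t′ ≤ proj₁ t + fromℕ k → (fold ω τ⁻¹ k , t′) ∈ o₋ (ω , t)
  τ⁻ᵏ∈o₋ k ω t t′ t′≤t+k = s , x≤y⇒0≤y-x t′≤t+k , orbit k refl
    where
    s = proj₁ t + fromℕ k - proj₁ t′

    u≈t′+j : ∀ {j} → j ≈ - fromℕ k → proj₁ t - s ≈ proj₁ t′ + j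
    u≈t′+j {j} j≈-k = begin-equality
      proj₁ t - s               ≈⟨ solve 3 (λ t k t′ → t :- (t :+ k :- t′) := t′ :- k) refl _ _ _ ⟩
      proj₁ t′ + - fromℕ k      ≈⟨ +-congˡ j≈-k ⟨
      proj₁ t′ + j              ∎

    -- The integer -k is `+ 0` or `-[1+ i ]`, so k must be split by cases; splitting a copy i leaves
    -- the flow time s unchanged.
    orbit : ∀ i → fromℕ i ≈ fromℕ k → (fold ω τ⁻¹ i , t′) ∼ φ (- s) (ω , t)
    orbit zero    eq = normal-form (+ 0) ω t′ (u≈t′+j (trans (sym RP.-0#≈0#) (-‿cong eq)))
    orbit (suc i) eq = normal-form -[1+ i ] ω t′ (u≈t′+j (-‿cong eq))

  -- A step δ fits into the gap between t and t′ and multiplies 2^t by 1 + d > 1.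
  2^-strict : ∀ t t′ → proj₁ t < proj₁ t′ → 2^ t < 2^ t′
  2^-strict t t′ t<t′ =
    let gap                                 = proj₁ t′ - proj₁ t
        d , δ , 0<d , _ , _ , δ≤gap , up , _ = 2^-modulus gap (x<y⇒0<y-x t<t′)
    in begin-strict
      2^ t                 <⟨ x<x+pos _ (*-pos (<-≤-trans 0<1 (1≤2^ t)) 0<d) ⟩
      2^ t + 2^ t * d      ≈⟨ solve 2 (λ x d → x :+ x :* d := x :* (con (+ 1) :+ d)) refl _ d ⟩
      2^ t * (1# + d)      ≤⟨ up t t′ (begin
                                proj₁ t + δ       ≤⟨ +-monoʳ-≤ _ δ≤gap ⟩
                                proj₁ t + gap     ≈⟨ solve 2 (λ t t′ → t :+ (t′ :- t) := t′) refl _ _ ⟩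
                                proj₁ t′          ∎) ⟩
      2^ t′                ∎

  just-below : ∀ (t : I) ε → 0# < ε → 0# < proj₁ t → Σ[ t₁ ∈ I ] proj₁ t₁ < proj₁ t × proj₁ t ≤ proj₁ t₁ + ε
  just-below (t , 0≤t , t≤1) ε 0<ε 0<t with O.compare t ε
  ... | tri< t<ε _ _ = (0# , ≤-refl , 0≤1) , 0<t , ≤-trans (inj₁ t<ε) (inj₂ (sym (+-identityˡ ε)))
  ... | tri≈ _ t≈ε _ = (0# , ≤-refl , 0≤1) , 0<t , inj₂ (trans t≈ε (sym (+-identityˡ ε)))
  ... | tri> _ _ ε<t = (t - ε , inj₁ (x<y⇒0<y-x ε<t) , ≤-trans (inj₁ (x-pos<x t 0<ε)) t≤1)
                     , x-pos<x t 0<ε , inj₂ (sym (x-z+z≈x t ε))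

  Block : 𝒫ℕ⁺ → I → I → 𝒫ℕ⁺
  Block B t₁ t′ m = ∃[ j ] j ∈ B × scale t₁ j < fromℕ (toℕ m) × fromℕ (toℕ m) ≤ scale t′ j

  -- For n in B the block of index n alone fills the upper end of [1, 2^t′·2^n], a part of length
  -- (2^t′ - 2^t₁)·2^n.
  Block-fat : ∀ {B ω′} t₁ t′ → ω′ ∋ B → proj₁ t₁ < proj₁ t′ → ¬ Null (ω′ , t′) (Block B t₁ t′)
  Block-fat {B} {ω′} t₁ t′ B∈ω′ t₁<t′ null = proper (proj₁ ω′) (upward* ω′ clash
    (meet (proj₁ ω′) (meet (proj₁ ω′) B∈ω′ (null ε 0<ε)) (eventually-2^> ω′ (h ⁻¹))))
    where
    -- The block has length D·P with P = 2^n. Half of it, hP, absorbs the rounding error 1; with ε =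
    -- D/4 thinness leaves fewer than ε·2P = hP elements, the other half.
    D = 2^ t′ - 2^ t₁
    h = D * 2# ⁻¹
    ε = h * 2# ⁻¹
    0<h = *-pos (x<y⇒0<y-x (2^-strict t₁ t′ t₁<t′)) (⁻¹-pos 0<2)
    0<ε = *-pos 0<h (⁻¹-pos 0<2)
    A = Block B t₁ t′

    clash : ∀ n → ¬ ((n ∈ B × Thin A ε (scale t′ n)) × h ⁻¹ < 2# ^ toℕ n)
    clash n ((n∈B , thin) , h⁻¹<2^n) = O.irrefl refl (begin-strict
      x′                                  <⟨ x<1+∣⌊x⌋∣ x′ ⟩
      1# + fromℕ m′                       ≤⟨ +-monoʳ-≤ 1# (fromℕ-mono (count-interval A m₁ m′ interval)) ⟩
      1# + fromℕ (count A m′ ℕ.+ m₁)      ≈⟨ +-congˡ (fromℕ-+ (count A m′) m₁) ⟩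
      1# + (fromℕ (count A m′) + fromℕ m₁) <⟨ +-monoʳ-< 1# (+-monoˡ-< _ thin) ⟩
      1# + (ε * x′ + fromℕ m₁)            ≤⟨ +-mono-≤ 1≤hP (+-mono-≤ (*-monoʳ-≤ ε 0<ε (scale≤2*2^n t′ n))
                                                (∣⌊⌋∣≤ (inj₁ (scale-pos t₁ n)))) ⟩
      h * P + (ε * (2# * P) + x₁)         ≈⟨ +-congˡ (+-congʳ (trans (sym (*-assoc ε 2# P)) (*-congʳ (x*y⁻¹*y≈x h 0<2)))) ⟩
      h * P + (h * P + x₁)                ≈⟨ solve 3 (λ h P x → h :* P :+ (h :* P :+ x) := h :* con (+ 2) :* P :+ x) refl h P x₁ ⟩
      h * 2# * P + x₁                     ≈⟨ +-congʳ (*-congʳ (x*y⁻¹*y≈x D 0<2)) ⟩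
      D * P + x₁                          ≈⟨ solve 3 (λ a b P → (a :- b) :* P :+ b :* P := a :* P) refl (2^ t′) (2^ t₁) P ⟩
      x′                                  ∎)
      where
      P = 2# ^ toℕ n
      x′ = scale t′ n
      x₁ = scale t₁ n
      m′ = ℤ.∣ ⌊ x′ ⌋ ∣
      m₁ = ℤ.∣ ⌊ x₁ ⌋ ∣

      1≤hP : 1# ≤ h * P
      1≤hP = ≤-trans (inj₂ (sym (*-inverseʳ h (pos⇒≉0 0<h)))) (*-monoʳ-≤ h 0<h (inj₁ h⁻¹<2^n))

      interval : ∀ j → m₁ ℕ.≤ j → j ℕ.< m′ → [1+ j ] ∈ A
      interval j m₁≤j j<m′ = n , n∈B
        , <-≤-trans (x<1+∣⌊x⌋∣ x₁) (fromℕ-mono (s≤s m₁≤j))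
        , ≤-trans (fromℕ-mono j<m′) (∣⌊⌋∣≤ (inj₁ (scale-pos t′ n)))

  -- An element of [1, x_n] cannot lie in a block of index above n, nor of index n when t ≤ t₁. For
  -- almost every n the K preceding indices miss B, so only blocks far below n remain, and their
  -- elements are smaller than ε·x_n.
  Block-null : ∀ {B} ω t t₁ t′ → (∀ i → ¬ ω ∋ shift[ suc i ] B) → (ω ∋ B → proj₁ t ≤ proj₁ t₁) →
    Null (ω , t) (Block B t₁ t′)
  Block-null {B} ω t t₁ t′ later now ε 0<ε = upward* ω thin (meet (proj₁ ω) (avoids K) same)
    where
    A = Block B t₁ t′
    K = proj₁ (2^-unbounded (ε ⁻¹))

    1<ε2^K : 1# < ε * 2# ^ K
    1<ε2^K = ≤-<-trans (inj₂ (sym (*-inverseʳ ε (pos⇒≉0 0<ε)))) (*-monoʳ-< ε 0<ε (proj₂ (2^-unbounded (ε ⁻¹))))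

    -- Ultrafilters are closed under finite intersections only, so the translates excluded at once
    -- are limited to K, chosen with 2^K > 1/ε.
    avoids : ∀ K → ω ∋ λ n → ∀ i → i ℕ.< K → n ∉ shift[ suc i ] B
    avoids zero    = upward* ω (λ _ _ _ ()) (universe (proj₁ ω))
    avoids (suc K) with total (proj₁ ω) (shift[ suc K ] B)
    ... | inj₁ p = ⊥-elim (later K p)
    ... | inj₂ p = upward* ω (λ { n (n∉ , avoid) i (s≤s i≤K) → step n n∉ avoid i (ℕₚ.m≤n⇒m<n∨m≡n i≤K) })
                     (meet (proj₁ ω) p (avoids K))
      where
      step : ∀ n → n ∉ shift[ suc K ] B → (∀ i → i ℕ.< K → n ∉ shift[ suc i ] B) →
        ∀ i → i ℕ.< K ⊎ i ≡ K → n ∉ shift[ suc i ] B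
      step n n∉ avoid i (inj₁ i<K)    = avoid i i<K
      step n n∉ avoid i (inj₂ ≡.refl) = n∉

    same : ω ∋ λ n → n ∈ B → proj₁ t ≤ proj₁ t₁
    same with total (proj₁ ω) B
    ... | inj₁ p = upward* ω (λ _ _ _ → now p) p
    ... | inj₂ p = upward* ω (λ n n∉B n∈B → ⊥-elim (n∉B n∈B)) p

    thin : ∀ n → (∀ i → i ℕ.< K → n ∉ shift[ suc i ] B) × (n ∈ B → proj₁ t ≤ proj₁ t₁) → Thin A ε (scale t n)
    thin n (avoid , same) = count-bound A ℤ.∣ ⌊ x ⌋ ∣ (*-pos 0<ε (scale-pos t n)) λ m m<⌊x⌋ (b , b∈B , lo , hi) →
      ≰⇒> λ εx≤m → absurd (≤-trans (fromℕ-mono m<⌊x⌋) (∣⌊⌋∣≤ (inj₁ (scale-pos t n)))) b b∈B lo hi εx≤m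
      where
      x = scale t n

      absurd : ∀ {m} → m ≤ x → ∀ b → b ∈ B → scale t₁ b < m → m ≤ scale t′ b → ¬ ε * x ≤ m
      absurd {m} m≤x b b∈B lo hi εx≤m with ℕₚ.<-cmp (pred b) (pred n)
      ... | tri≈ _ ≡.refl _ = ≤⇒≯ (≤-trans m≤x (scale-mono t t₁ n (same b∈B))) lo
      ... | tri> _ _ n<b = ≤⇒≯ (begin
        m                      ≤⟨ m≤x ⟩
        x                      ≤⟨ scale≤2*2^n t n ⟩
        2# * 2# ^ toℕ n        ≤⟨ 2^-mono {suc (toℕ n)} (s≤s n<b) ⟩
        2# ^ toℕ b             ≤⟨ 2^n≤scale t₁ b ⟩
        scale t₁ b             ∎) lo
      ... | tri< b<n _ _ with ℕₚ.m≤n⇒∃[o]m+o≡n b<n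
      ...   | i , 1+b+i≡n with ℕₚ.<-≤-connex i K
      ...     | inj₁ i<K = avoid i i<K (b , b∈B
                  , ≡.cong [1+_] (≡.trans (≡.sym 1+b+i≡n) (≡.cong suc (ℕₚ.+-comm (pred b) i))))
      -- Here n = b + i + 1 with i ≥ K: then ε·x_n ≥ ε·2^K·(2·2^b) > 2·2^b, which bounds the whole
      -- block of index b.
      ...     | inj₂ K≤i = O.irrefl refl (begin-strict
        2# * P                            ≈⟨ *-identityˡ _ ⟨
        1# * (2# * P)                     <⟨ *-monoˡ-< _ (*-pos 0<2 (^-pos (toℕ b) 0<2)) 1<ε2^K ⟩
        ε * 2# ^ K * (2# * P)             ≤⟨ *-monoˡ-≤ _ (*-pos 0<2 (^-pos (toℕ b) 0<2)) (*-monoʳ-≤ ε 0<ε (2^-mono K≤i)) ⟩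
        ε * 2# ^ i * (2# * P)             ≈⟨ solve 4 (λ e q two P → e :* q :* (two :* P) := e :* ((two :* q) :* P)) refl ε _ 2# P ⟩
        ε * (2# ^ suc i * P)              ≤⟨ *-monoʳ-≤ ε 0<ε (*-monoʳ-≤ _ (^-pos (suc i) 0<2) (2^n≤scale t b)) ⟩
        ε * (2# ^ suc i * scale t b)      ≈⟨ *-congˡ (scale-shift t (suc i) b) ⟨
        ε * scale t (shift (suc i) b)     ≡⟨ ≡.cong (λ k → ε * scale t [1+ k ]) (≡.trans (≡.cong suc (ℕₚ.+-comm i (pred b))) 1+b+i≡n) ⟩
        ε * x                             ≤⟨ εx≤m ⟩
        m                                 ≤⟨ hi ⟩
        scale t′ b                        ≤⟨ scale≤2*2^n t′ b ⟩
        2# * P                            ∎)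
        where
        P = 2# ^ toℕ b

  -- B and ε come from a basic neighbourhood of (ω′ , t′) inside V. If either hypothesis of
  -- `Block-null` failed, a point of the backward orbit would fall into this neighbourhood. The
  -- condition 0 < t′ leaves room for t₁ below t′.
  separate : ∀ {V η ω′ t′} → Open V → ¬ (o₋ η ≬ V) → (ω′ , t′) ∈ V → 0# < proj₁ t′ →
    ∃[ A ] Null η A × ¬ Null (ω′ , t′) A
  separate {V} {ω , t} {ω′} {t′} V-open disjoint η′∈V 0<t′ =
    let B , ε , B∈ω′ , 0<ε , nbhd = Open.open-nbhd V-open η′∈V
        t₁ , t₁<t′ , t′≤t₁+ε      = just-below t′ ε 0<ε 0<t′
        τ⁻ᵏ∈V = λ k B∈τ⁻ᵏω → nbhd (fold ω τ⁻¹ k) t′ B∈τ⁻ᵏω (x<x+pos _ 0<ε , x<x+pos _ 0<ε)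
    in Block B t₁ t′
     , Block-null {B} ω t t₁ t′
         (λ i p → disjoint (_ , τ⁻ᵏ∈o₋ (suc i) ω t t′ (begin
             proj₁ t′                    ≤⟨ proj₂ (proj₂ t′) ⟩
             1#                          ≤⟨ x≤x+nonneg 1# (fromℕ-nonneg i) ⟩
             fromℕ (suc i)               ≤⟨ x≤x+nonneg _ (proj₁ (proj₂ t)) ⟩
             fromℕ (suc i) + proj₁ t     ≈⟨ +-comm _ _ ⟩
             proj₁ t + fromℕ (suc i)     ∎)
           , τ⁻ᵏ∈V (suc i) (∋shift⇒τ⁻ᵏ∋ (suc i) ω p)))
         -- If t₁ < t < t′, then (ω , t) itself is within ε of t′ and lies in V; if t ≥ t′, flowing
         -- back by t - t′ reaches (ω , t′) in V.
         (λ B∈ω → ≮⇒≥ λ t₁<t → case O.compare (proj₁ t) (proj₁ t′) of λ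
           { (tri< t<t′ _ _) → disjoint (_ , τ⁻ᵏ∈o₋ 0 ω t t (x≤x+nonneg _ ≤-refl)
               , nbhd ω t B∈ω (O.trans t<t′ (x<x+pos _ 0<ε) , ≤-<-trans t′≤t₁+ε (+-monoˡ-< ε t₁<t)))
           ; (tri≈ _ t≈t′ _) → disjoint (_ , τ⁻ᵏ∈o₋ 0 ω t t′ (≤-trans (inj₂ (sym t≈t′)) (x≤x+nonneg _ ≤-refl))
               , τ⁻ᵏ∈V 0 B∈ω)
           ; (tri> _ _ t′<t) → disjoint (_ , τ⁻ᵏ∈o₋ 0 ω t t′ (≤-trans (inj₁ t′<t) (x≤x+nonneg _ ≤-refl))
               , τ⁻ᵏ∈V 0 B∈ω)
           })
     , Block-fat {B} {ω′} t₁ t′ B∈ω′ t₁<t′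

  -- The two implications.

  open NullOrbits em R

  ≺⇒∈closure : ∀ η η′ → ν η′ ≺ ν η → η′ ∈ closure (o₋ η)
  ≺⇒∈closure η η′@(ω′ , t′) ν′≺ν V V-open η′∈V with em {P = o₋ η ≬ V}
  ... | yes meets    = meets
  ... | no  disjoint = ⊥-elim (inseparable (separated (proj₁ (proj₂ t′))))
    where
    inseparable : ¬ (∃[ A ] Null η A × ¬ Null η′ A)
    inseparable (A , null , ¬null) = ¬null (ν≈0⇒Null η′ A (ν′≺ν A (Null⇒ν≈0 η A null)))

    separated : 0# ≤ proj₁ t′ → ∃[ A ] Null η A × ¬ Null η′ A
    separated (inj₁ 0<t′) = separate {V} {η} {ω′} {t′} V-open disjoint η′∈V 0<t′
    -- At t′ = 0 there is no room on the left, so the representative (τ⁻¹ω′ , 1) of the same point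
    -- is used.
    separated (inj₂ 0≈t′) =
      let one : I
          one = 1# , 0≤1 , ≤-refl
          ω′≈ττ⁻¹ω′ : ω′ ≈ᵤ τ (τ⁻¹ ω′)
          ω′≈ττ⁻¹ω′ = proj₂ (ττ⁻¹ ω′) , proj₁ (ττ⁻¹ ω′)
          A , null , ¬null = separate {V} {η} {τ⁻¹ ω′} {one} V-open disjoint
            (Open.saturated V-open (EqClosure.symmetric Glue (EqClosure.return
              (glue {τ⁻¹ ω′} {ω′} {one} {t′} refl ω′≈ττ⁻¹ω′ (sym 0≈t′)))) η′∈V) 0<1
      in A , null , λ null′ → ¬null (Null-glue⇐ {A} {τ⁻¹ ω′} {ω′} one t′ refl ω′≈ττ⁻¹ω′ (sym 0≈t′) null′)

  -- If A were not null at η′, the open set from `¬Null-open` would meet the backward orbit,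
  -- contrary to `Null-o₋`.
  ∈closure⇒≺ : ∀ η η′ → η′ ∈ closure (o₋ η) → ν η′ ≺ ν η
  ∈closure⇒≺ η η′ η′∈cl A ν≈0 with em {P = Null η′ A}
  ... | yes null = Null⇒ν≈0 η′ A null
  ... | no ¬null with η′∈cl (λ ζ → ¬ Null ζ A) (¬Null-open A) ¬null
  ...   | ζ , ζ∈o₋ , ¬nullζ = ⊥-elim (¬nullζ (Null-o₋ {A} {η} ζ∈o₋ (ν≈0⇒Null η A ν≈0)))

theorem3p7 : (em : ∀ {ℓ} → ExcludedMiddle ℓ) (R : CompleteOrderedField) →
    let open Construction em R in
    (η η′ : Ω*) → (ν η′ ≺ ν η) ⇔ (η′ ∈ closure (o₋ η))
theorem3p7 em R η η′ = mk⇔ (≺⇒∈closure η η′) (∈closure⇒≺ η η′)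
  where open SeparatingSets em R
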